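{- For every integer $k\ge 1$, $$f_k(-1)=\sum_{i=0}^{k-1}(-1)^i\,|\mathrm{RedVHC}_k(\mathrm{Av}_{3k-i}(312))| = C_k,$$ where $f_k(x)=\sum_{i=0}^{k-1}|\mathrm{RedVHC}_k(\mathrm{Av}_{3k-i}(312))|\,x^i$ and $C_k=\frac{1}{k+1}\binom{2k}{k}$ is the $k$-th Catalan number.
   Context: $S_n$ is the set of permutations $\pi=\pi_1\cdots\pi_n$ of $\{1,\dots,n\}$. $\pi$ is $312$-avoiding if there are no indices $a<b<c$ with $\pi_b<\pi_c<\pi_a$; $\mathrm{Av}_n(312)\subseteq S_n$ is the set of $312$-avoiding permutations of length $n$. The plot of $\pi$ is the set of points $(i,\pi_i)$, $1\le i\le n$. If $\pi_i>\pi_{i+1}$, then $i$ is a descent, $(i,\pi_i)$ is a descent top and $(i+1,\pi_{i+1})$ is a descent bottom. A hook on $\pi$ from $(i,\pi_i)$ to $(j,\pi_j)$, where $i<j$ and $\pi_i<\pi_j$, consists of the vertical segment from $(i,\pi_i)$ up to $(i,\pi_j)$ followed by the horizontal segment from $(i,\pi_j)$ to $(j,\pi_j)$. The point $(i,\pi_i)$ is its southwest (SW) endpoint and $(j,\pi_j)$ its northeast (NE) endpoint. A valid hook configuration on $\pi$ is a set of hooks on $\pi$ such that: (i) the set of SW endpoints of the hooks is exactly the set of descent tops of $\pi$; (ii) no point of the plot lies directly above a hook (for a hook from $(i,\pi_i)$ to $(j,\pi_j)$ there is no $l$ with $i<l<j$ and $\pi_l>\pi_j$); (iii) distinct hooks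 do not intersect, except at endpoints (the NE endpoint of one hook may be the SW endpoint of another; two hooks sharing the same NE endpoint, or the same SW endpoint, overlap in a segment and are not allowed). It is reduced if every point of the plot is a hook endpoint or a descent bottom (or both). For a set $S$ of permutations, $\mathrm{RedVHC}_k(S)$ is the set of all reduced valid hook configurations with exactly $k$ hooks on permutations in $S$ (a configuration includes the data of its underlying permutation). -}

module Defs where

open import Level using (0ℓ)
open import Data.Bool using (Bool; true; false)
open import Data.Fin using (Fin; toℕ; _<_; _≤_; _>_; _<?_; _≤?_; _≟_)
open import Data.Fin.Properties using (all?; any?)
open import Data.Fin.Subset using (Subset; _∈_; ∣_∣)
open import Data.Fin.Subset.Properties using (_∈?_)
open import Data.Integer as ℤ using (ℤ; +_)
open import Data.Integer.Properties using (+-0-monoid)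
open import Algebra.Properties.Monoid.Sum +-0-monoid using (sum-syntax)
open import Data.List as List using (List; []; _∷_; allFin; cartesianProduct; cartesianProductWith; filter; length)
import Data.List.Membership.Propositional as List
open import Data.List.Membership.Propositional.Properties using (∈-allFin; ∈-cartesianProduct⁺; ∈-cartesianProductWith⁺; ∈-filter⁺; ∈-filter⁻)
open import Data.List.Relation.Unary.All as All using ()
open import Data.List.Relation.Unary.AllPairs using ([]; _∷_)
open import Data.List.Relation.Unary.Any using (here; there)
open import Data.List.Relation.Unary.Unique.Propositional using (Unique)
import Data.List.Relation.Unary.Unique.Propositional.Properties as Unique
open import Data.Nat as ℕ using (ℕ; zero; suc; _∸_)
import Data.Nat.Properties as ℕ
open import Data.Nat.Combinatorics using (_C_; nCk+nC[k+1]≡[n+1]C[k+1]; k>n⇒nCk≡0; nC1≡n)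
open import Data.Nat.DivMod using (_/_)
open import Data.Nat.Divisibility using (_∣_; divides; m∣m*n; ∣m+n∣m⇒∣n)
open import Data.Nat.Tactic.RingSolver using (solve-∀)
open import Data.Product using (∃; ∃-syntax; _×_; _,_; proj₁; proj₂)
open import Data.Product.Properties using (≡-dec)
open import Data.Sum using (_⊎_)
open import Data.Vec as Vec using (Vec; []; _∷_; lookup)
open import Data.Vec.Properties using (∷-injective)
open import Function using (_⇔_; mk⇔; Equivalence; _∘_; Bijective)
open import Relation.Binary.PropositionalEquality using (_≡_; _≢_; refl; cong; cong₂; sym; trans; module ≡-Reasoning)
open import Relation.Nullary using (Dec; ¬_; ¬?; map′; _×-dec_; _⊎-dec_; _→-dec_)
open import Relation.Unary using (Pred; Decidable)

private
  variable
    n : ℕ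

-- One-line notation, with positions and values numbered from 0.
Word : ℕ → Set
Word n = Vec (Fin n) n

IsPermutation : Pred (Word n) 0ℓ
IsPermutation π = Bijective _≡_ _≡_ (lookup π)

Contains312 : Pred (Word n) 0ℓ
Contains312 π = ∃[ a ] ∃[ b ] ∃[ c ]
  (a < b × b < c × lookup π b < lookup π c × lookup π c < lookup π a)

Av312 : Pred (Word n) 0ℓ
Av312 π = IsPermutation π × ¬ Contains312 π

-- Descent tops and bottoms, like all points of the plot, are
-- identified with their x-coordinates.
IsDescentTop : Word n → Pred (Fin n) 0ℓ
IsDescentTop π i = ∃[ i′ ] (toℕ i′ ≡ suc (toℕ i) × lookup π i > lookup π i′)

IsDescentBottom : Word n → Pred (Fin n) 0ℓ
IsDescentBottom π i′ = ∃[ i ] (toℕ i′ ≡ suc (toℕ i) × lookup π i > lookup π i′)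

-- The hook from (i , πᵢ) to (j , πⱼ) is encoded as (i , j).
Hook : ℕ → Set
Hook n = Fin n × Fin n

IsHook : Word n → Pred (Hook n) 0ℓ
IsHook π (i , j) = i < j × lookup π i < lookup π j

-- Only lattice points of the plane are needed: hooks are unions of
-- axis-parallel segments between lattice points, so two hooks that meet
-- do so in a lattice point, and two hooks that overlap in a segment share
-- both of its (lattice) ends.  All lattice points of a hook lie in the
-- n × n grid.
Point : ℕ → Set
Point n = Fin n × Fin n

OnVertical OnHorizontal OnHook IsEndpoint : Word n → Hook n → Pred (Point n) 0ℓ
OnVertical   π (i , j) (x , y) = x ≡ i × lookup π i ≤ y × y ≤ lookup π j
OnHorizontal π (i , j) (x , y) = y ≡ lookup π j × i ≤ x × x ≤ j
OnHook       π h       p       = OnVertical π h p ⊎ OnHorizontal π h p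
IsEndpoint   π (i , j) p       = p ≡ (i , lookup π i) ⊎ p ≡ (j , lookup π j)

-- A set of pairs (i , j), as a Boolean matrix: row i is the set of all j
-- such that (i , j) belongs to the set.  Hence propositional equality is
-- equality of sets.
HookSet : ℕ → Set
HookSet n = Vec (Subset n) n

infix 4 _∈ₕ_

_∈ₕ_ : Hook n → HookSet n → Set
(i , j) ∈ₕ H = j ∈ lookup H i

∣_∣ₕ : HookSet n → ℕ
∣ H ∣ₕ = Vec.sum (Vec.map ∣_∣ H)

record IsVHC (π : Word n) (H : HookSet n) : Set where
  field
    hooks         : ∀ h → h ∈ₕ H → IsHook π h
    southwest     : ∀ i → (∃[ j ] (i , j) ∈ₕ H) ⇔ IsDescentTop π i
    nothingAbove  : ∀ i j → (i , j) ∈ₕ H →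
                    ¬ (∃[ l ] (i < l × l < j × lookup π l > lookup π j))
    nonIntersect  : ∀ h h′ → h ∈ₕ H → h′ ∈ₕ H → h ≢ h′ →
                    ∀ p → OnHook π h p → OnHook π h′ p →
                    IsEndpoint π h p × IsEndpoint π h′ p

IsReduced : Word n → HookSet n → Set
IsReduced π H = ∀ i →
  (∃[ j ] (i , j) ∈ₕ H) ⊎ (∃[ j ] (j , i) ∈ₕ H) ⊎ IsDescentBottom π i

Configuration : ℕ → Set
Configuration n = Word n × HookSet n

RedVHC : ℕ → Pred (Word n) 0ℓ → Pred (Configuration n) 0ℓ
RedVHC k S (π , H) = S π × IsVHC π H × IsReduced π H × ∣ H ∣ₕ ≡ k

private
  all²? : {P : Pred (Fin n × Fin n) 0ℓ} → Decidable P → Dec (∀ p → P p)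
  all²? P? = map′ (λ f (i , j) → f i j) (λ f i j → f (i , j))
                  (all? λ i → all? λ j → P? (i , j))

  _⇔-dec_ : {A B : Set} → Dec A → Dec B → Dec (A ⇔ B)
  a? ⇔-dec b? = map′ (λ (f , g) → mk⇔ f g) (λ e → to e , from e)
                     ((a? →-dec b?) ×-dec (b? →-dec a?))
    where open Equivalence

  _≟²_ : (p q : Fin n × Fin n) → Dec (p ≡ q)
  _≟²_ = ≡-dec _≟_ _≟_

isPermutation? : Decidable (IsPermutation {n})
isPermutation? π =
  map′ (λ f {x} {y} → f x y) (λ f x y → f {x} {y})
       (all? λ x → all? λ y → (lookup π x ≟ lookup π y) →-dec (x ≟ y))
  ×-dec
  all? λ y → any? λ x →
    map′ (λ f {z} → f z) (λ f z → f {z})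
         (all? λ z → (z ≟ x) →-dec (lookup π z ≟ y))

contains312? : Decidable (Contains312 {n})
contains312? π = any? λ a → any? λ b → any? λ c →
  (a <? b) ×-dec (b <? c) ×-dec
  (lookup π b <? lookup π c) ×-dec (lookup π c <? lookup π a)

av312? : Decidable (Av312 {n})
av312? π = isPermutation? π ×-dec ¬? (contains312? π)

isDescentTop? : (π : Word n) → Decidable (IsDescentTop π)
isDescentTop? π i = any? λ i′ →
  (toℕ i′ ℕ.≟ suc (toℕ i)) ×-dec (lookup π i′ <? lookup π i)

isDescentBottom? : (π : Word n) → Decidable (IsDescentBottom π)
isDescentBottom? π i′ = any? λ i →
  (toℕ i′ ℕ.≟ suc (toℕ i)) ×-dec (lookup π i′ <? lookup π i)

isHook? : (π : Word n) → Decidable (IsHook π)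
isHook? π (i , j) = (i <? j) ×-dec (lookup π i <? lookup π j)

onHook? : (π : Word n) (h : Hook n) → Decidable (OnHook π h)
onHook? π (i , j) (x , y) =
  ((x ≟ i) ×-dec (lookup π i ≤? y) ×-dec (y ≤? lookup π j))
  ⊎-dec
  ((y ≟ lookup π j) ×-dec (i ≤? x) ×-dec (x ≤? j))

isEndpoint? : (π : Word n) (h : Hook n) → Decidable (IsEndpoint π h)
isEndpoint? π (i , j) p = (p ≟² (i , lookup π i)) ⊎-dec (p ≟² (j , lookup π j))

infix 4 _∈ₕ?_

_∈ₕ?_ : (h : Hook n) (H : HookSet n) → Dec (h ∈ₕ H)
(i , j) ∈ₕ? H = j ∈? lookup H i

isVHC? : (π : Word n) (H : HookSet n) → Dec (IsVHC π H)
isVHC? π H =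
  map′ (λ (a , b , c , d) → record
         { hooks = a ; southwest = b ; nothingAbove = c ; nonIntersect = d })
       (λ v → let open IsVHC v in hooks , southwest , nothingAbove , nonIntersect)
       ( all²? (λ h → (h ∈ₕ? H) →-dec isHook? π h)
       ×-dec all? (λ i → any? (λ j → (i , j) ∈ₕ? H) ⇔-dec isDescentTop? π i)
       ×-dec all? (λ i → all? λ j → ((i , j) ∈ₕ? H) →-dec
               ¬? (any? λ l → (i <? l) ×-dec (l <? j) ×-dec
                              (lookup π j <? lookup π l)))
       ×-dec all²? (λ h → all²? λ h′ →
               (h ∈ₕ? H) →-dec ((h′ ∈ₕ? H) →-dec (¬? (h ≟² h′) →-dec
               all²? λ p → onHook? π h p →-dec (onHook? π h′ p →-dec
               (isEndpoint? π h p ×-dec isEndpoint? π h′ p))))))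

isReduced? : (π : Word n) (H : HookSet n) → Dec (IsReduced π H)
isReduced? π H = all? λ i →
  any? (λ j → (i , j) ∈ₕ? H) ⊎-dec
  any? (λ j → (j , i) ∈ₕ? H) ⊎-dec
  isDescentBottom? π i

redVHC? : ∀ k {S : Pred (Word n) 0ℓ} → Decidable S → Decidable (RedVHC k S)
redVHC? k S? (π , H) =
  S? π ×-dec isVHC? π H ×-dec isReduced? π H ×-dec (∣ H ∣ₕ ℕ.≟ k)

allVecs : {A : Set} → List A → ∀ m → List (Vec A m)
allVecs xs zero    = [] ∷ []
allVecs xs (suc m) = cartesianProductWith _∷_ xs (allVecs xs m)

allVecs-complete : {A : Set} {xs : List A} → (∀ x → x List.∈ xs) →
                   ∀ {m} (v : Vec A m) → v List.∈ allVecs xs m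
allVecs-complete all∈ []      = here refl
allVecs-complete all∈ (x ∷ v) =
  ∈-cartesianProductWith⁺ _∷_ (all∈ x) (allVecs-complete all∈ v)

allVecs-unique : {A : Set} {xs : List A} → Unique xs →
                 ∀ m → Unique (allVecs xs m)
allVecs-unique xs! zero    = All.[] ∷ []
allVecs-unique xs! (suc m) =
  Unique.cartesianProductWith⁺ _∷_ ∷-injective xs! (allVecs-unique xs! m)

bools : List Bool
bools = true ∷ false ∷ []

bools-complete : ∀ b → b List.∈ bools
bools-complete true  = here refl
bools-complete false = there (here refl)

bools-unique : Unique bools
bools-unique = ((λ ()) All.∷ All.[]) ∷ All.[] ∷ []

allConfigurations : ∀ n → List (Configuration n)
allConfigurations n =
  cartesianProduct (allVecs (allFin n) n) (allVecs (allVecs bools n) n)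

redVHCs : ∀ k {S : Pred (Word n) 0ℓ} → Decidable S → List (Configuration n)
redVHCs {n} k S? = filter (redVHC? k S?) (allConfigurations n)

#RedVHC : ∀ k {S : Pred (Word n) 0ℓ} → Decidable S → ℕ
#RedVHC k S? = length (redVHCs k S?)

-- The next two facts say that #RedVHC k S? is the cardinality of RedVHC k S.

∈-redVHCs : ∀ k {S : Pred (Word n) 0ℓ} (S? : Decidable S) {c} →
            c List.∈ redVHCs k S? ⇔ RedVHC k S c
∈-redVHCs {n} k S? {π , H} = mk⇔
  (proj₂ ∘ ∈-filter⁻ (redVHC? k S?) {xs = allConfigurations n})
  (∈-filter⁺ (redVHC? k S?) (∈-cartesianProduct⁺
    (allVecs-complete ∈-allFin π)
    (allVecs-complete (allVecs-complete bools-complete) H)))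

redVHCs-unique : ∀ k {S : Pred (Word n) 0ℓ} (S? : Decidable S) →
                 Unique (redVHCs k S?)
redVHCs-unique {n} k S? = Unique.filter⁺ (redVHC? k S?)
  (Unique.cartesianProduct⁺
    (allVecs-unique (Unique.allFin⁺ n) n)
    (allVecs-unique (allVecs-unique bools-unique n) n))

#RedVHC-Av312 : ℕ → ℕ → ℕ
#RedVHC-Av312 k n = #RedVHC k (av312? {n})

f : ℕ → ℤ → ℤ
f k x = ∑[ i < k ] (+ #RedVHC-Av312 k (3 ℕ.* k ∸ toℕ i) ℤ.* x ℤ.^ toℕ i)

catalan : ℕ → ℕ
catalan k = ((2 ℕ.* k) C k) / suc k

absorption : ∀ n k → suc k ℕ.* (suc n C suc k) ≡ suc n ℕ.* (n C k)
absorption n zero =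
  trans (ℕ.*-identityˡ _) (trans (nC1≡n (suc n)) (sym (ℕ.*-identityʳ _)))
absorption zero (suc k) =
  trans (cong (suc (suc k) ℕ.*_) (k>n⇒nCk≡0 (ℕ.s≤s (ℕ.s≤s (ℕ.z≤n {k})))))
        (trans (ℕ.*-zeroʳ k) (cong (1 ℕ.*_) (sym (k>n⇒nCk≡0 (ℕ.s≤s (ℕ.z≤n {k}))))))
absorption (suc n) (suc k) = begin
  (2 ℕ.+ k) ℕ.* ((2 ℕ.+ n) C (2 ℕ.+ k))
    ≡⟨ cong ((2 ℕ.+ k) ℕ.*_) (nCk+nC[k+1]≡[n+1]C[k+1] (suc n) (suc k)) ⟨
  (2 ℕ.+ k) ℕ.* (a ℕ.+ b)
    ≡⟨ regroup k a b ⟩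
  a ℕ.+ (suc k ℕ.* a ℕ.+ (2 ℕ.+ k) ℕ.* b)
    ≡⟨ cong (a ℕ.+_) (cong₂ ℕ._+_ (absorption n k) (absorption n (suc k))) ⟩
  a ℕ.+ (suc n ℕ.* (n C k) ℕ.+ suc n ℕ.* (n C suc k))
    ≡⟨ cong (a ℕ.+_) (ℕ.*-distribˡ-+ (suc n) (n C k) (n C suc k)) ⟨
  a ℕ.+ suc n ℕ.* (n C k ℕ.+ n C suc k)
    ≡⟨ cong (λ z → a ℕ.+ suc n ℕ.* z) (nCk+nC[k+1]≡[n+1]C[k+1] n k) ⟩
  (2 ℕ.+ n) ℕ.* a ∎
  where
  open ≡-Reasoning
  a = suc n C suc k
  b = suc n C (2 ℕ.+ k)
  regroup : ∀ k a b → (2 ℕ.+ k) ℕ.* (a ℕ.+ b) ≡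
                      a ℕ.+ (suc k ℕ.* a ℕ.+ (2 ℕ.+ k) ℕ.* b)
  regroup = solve-∀

-- The division in catalan is exact.
1+k∣2kCk : ∀ k → suc k ∣ (2 ℕ.* k) C k
1+k∣2kCk k = ∣m+n∣m⇒∣n
  (divides (2 ℕ.* c) (split k c))
  (divides (suc (2 ℕ.* k) C suc k)
    (trans (sym (absorption (2 ℕ.* k) k)) (ℕ.*-comm (suc k) _)))
  where
  c = (2 ℕ.* k) C k
  split : ∀ k c → suc (2 ℕ.* k) ℕ.* c ℕ.+ c ≡ 2 ℕ.* c ℕ.* suc k
  split = solve-∀

{-# OPTIONS --safe #-}
module Submission where

-- A 312-avoiding permutation is read off a stack: before time t the values
-- below the running maximum that are still to come sit on a stack, and every
-- value that is not a new maximum is the top of that stack.  In the same way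
-- the open hooks form a second stack, since hooks do not cross.  A reduced
-- configuration is thus a sequence of steps: a descent bottom (which pops the
-- value stack and opens a hook), or a new maximum after p ≥ 0 skipped values,
-- which either closes the top hook or is followed by a descent bottom.
--
-- Weigh a configuration of length n by (-1)ⁿ.  A descent bottom and a new
-- maximum with p = 0 followed by a descent bottom change both stacks in the same
-- way but have opposite signs, so they cancel.  What remains never decreases
-- the value stack, hence must keep it empty, and consists of ballot sequences of
-- opening steps (p = 1) and closing steps (p = 0): these are counted by
-- Catalan numbers.

open import Defs
open import Data.Bool using (true; false)
open import Data.Empty using (⊥; ⊥-elim)
open import Data.Fin as Fin using (Fin; toℕ; fromℕ<)
import Data.Fin.Properties as Fin
open import Data.Fin.Subset as Subset using (Subset; ∣_∣; ⁅_⁆)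
import Data.Fin.Subset.Properties as Subset
open import Data.Integer as ℤ using (ℤ; +_; -_; 0ℤ; 1ℤ; _*_; _^_)
open import Data.Integer.Properties using (+-0-monoid)
import Data.Integer.Properties as ℤ
open import Data.Integer.Tactic.RingSolver using () renaming (solve-∀ to solveℤ-∀)
open import Algebra.Properties.Monoid.Sum +-0-monoid using (sum; sum-syntax; sum-cong-≗; sum-replicate-zero)
open import Algebra.Properties.CommutativeMonoid.Sum ℤ.+-0-commutativeMonoid using (∑-distrib-+)
open import Data.List as List using (List; []; _∷_; _++_; applyUpTo; concatMap; filter; length; map; upTo)
import Data.List.Properties as List
open import Data.List.Membership.Propositional using (_∈_; find; lose)
open import Data.List.Membership.Propositional.Properties
open import Data.List.Relation.Unary.All as All using (All; []; _∷_)
import Data.List.Relation.Unary.All.Properties as All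
open import Data.List.Relation.Unary.AllPairs as AllPairs using (AllPairs; []; _∷_)
import Data.List.Relation.Unary.AllPairs.Properties as AllPairs
open import Data.List.Relation.Unary.Any using (here; there)
open import Data.List.Relation.Unary.Unique.Propositional using (Unique)
import Data.List.Relation.Unary.Unique.Propositional.Properties as Unique
open import Data.Maybe using (Maybe; just; nothing)
import Data.Maybe.Properties as Maybe
open import Data.Nat as ℕ using (ℕ; zero; suc; pred; _+_; _∸_; _≤_; _<_; _>_; _<?_; z≤n; s≤s)
open import Data.Nat.Combinatorics using (_C_; nCk≡nC[n∸k]; nCk+nC[k+1]≡[n+1]C[k+1])
open import Data.Nat.DivMod using (_/_; m*n/n≡m)
import Data.Nat.Properties as ℕ
open import Data.Nat.Tactic.RingSolver using (solve-∀)
open import Data.Product using (∃-syntax; _×_; _,_; proj₁; proj₂; swap)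
open import Data.Sum as Sum using (_⊎_; inj₁; inj₂)
open import Data.Vec as Vec using (Vec; []; _∷_; lookup; tabulate)
import Data.Vec.Properties as Vec
open import Function using (_∘_; _⇔_; mk⇔; Equivalence)
open import Relation.Binary using (tri<; tri≈; tri>)
open import Relation.Binary.PropositionalEquality
open import Relation.Nullary using (Dec; does; ¬_; yes; no; contradiction)
open import Relation.Nullary.Decidable using (dec-true; map′)

-- The cancellation needs no involution on configurations. Two cancelling continuations lead to
-- states with equally many descents ahead, equally many open hooks and the same value stack, and
-- the signed number of continuations depends on nothing else. It therefore has a closed form, which
-- is checked along the recursion that generates the traces.
--
-- In what survives, opening a hook takes two points and closing it takes one, so all survivors have
-- length 3k and sign (-1)^k. This sign disappears because length 3k - i is counted with (-1)^i. The
-- range of i comes from the points themselves: each descent accounts for its bottom, one northeast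
-- endpoint and at most one further descent top. The first point is always of the last kind, whence
-- 2k < n ≤ 3k.
--
-- The laborious part is the comparison with the definition, where configurations of different
-- lengths have different types and disjointness is geometric. Functions on ℕ mediate: one gives the
-- values, one the southwest partner of each northeast endpoint, and disjointness becomes a few
-- inequalities between endpoints.

private
  variable
    n k : ℕ

-- Ballot numbers

-- Counts the ways to finish when `b` hooks are yet to be opened and `g` are open: paths from height
-- `g` to 0 with `b` up-steps that never go below 0.
ballot : ℕ → ℕ → ℕ
ballot zero    zero    = 1
ballot zero    (suc g) = ballot zero g
ballot (suc b) zero    = ballot b 1
ballot (suc b) (suc g) = ballot (suc b) g ℕ.+ ballot b (2 ℕ.+ g)

-- N C (b − 1), with value 0 at b = 0.
infixl 6.5 _C⁻_
_C⁻_ : ℕ → ℕ → ℕ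
N C⁻ zero  = 0
N C⁻ suc b = N C b

pascal : ∀ N b → suc N C b ≡ N C⁻ b ℕ.+ N C b
pascal N zero    = refl
pascal N (suc b) = sym (nCk+nC[k+1]≡[n+1]C[k+1] N b)

middle-C : ∀ b → suc (b ℕ.+ b) C b ≡ suc (b ℕ.+ b) C suc b
middle-C b = sym (trans
  (nCk≡nC[n∸k] (ℕ.s≤s (ℕ.m≤m+n b b)))
  (cong (suc (b ℕ.+ b) C_) (ℕ.m+n∸m≡n b b)))

-- The reflection principle.
ballot-C : ∀ b g N → N ≡ b ℕ.+ b ℕ.+ g → ballot b g ℕ.+ N C⁻ b ≡ N C b
ballot-C zero zero    N eq = refl
ballot-C zero (suc g) N eq = ballot-C zero g g refl
ballot-C (suc b) zero N refl = begin
  y ℕ.+ N C b                   ≡⟨ cong (y ℕ.+_) (pascal M b) ⟩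
  y ℕ.+ (M C⁻ b ℕ.+ M C b)      ≡⟨ ℕ.+-assoc y _ _ ⟨
  y ℕ.+ M C⁻ b ℕ.+ M C b        ≡⟨ cong (ℕ._+ M C b) (ballot-C b 1 M (M≡ b)) ⟩
  -- With no open hook the recurrence has no closing term; the symmetry of the odd row `M` takes its
  -- place.
  M C b ℕ.+ M C b               ≡⟨ cong (M C b ℕ.+_) M-middle ⟩
  M C b ℕ.+ M C suc b           ≡⟨ pascal M (suc b) ⟨
  N C suc b                     ∎
  where
  open ≡-Reasoning
  y = ballot b 1
  M = b ℕ.+ suc b ℕ.+ 0
  M≡ : ∀ b → b ℕ.+ suc b ℕ.+ 0 ≡ b ℕ.+ b ℕ.+ 1
  M≡ = solve-∀
  M≡′ : ∀ b → b ℕ.+ suc b ℕ.+ 0 ≡ suc (b ℕ.+ b)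
  M≡′ = solve-∀
  M-middle : M C b ≡ M C suc b
  M-middle = subst (λ M → M C b ≡ M C suc b) (sym (M≡′ b)) (middle-C b)
ballot-C (suc b) (suc g) N refl = begin
  x ℕ.+ y ℕ.+ N C b                     ≡⟨ cong (x ℕ.+ y ℕ.+_) (pascal M b) ⟩
  x ℕ.+ y ℕ.+ (M C⁻ b ℕ.+ M C b)        ≡⟨ regroup x y (M C⁻ b) (M C b) ⟩
  (y ℕ.+ M C⁻ b) ℕ.+ (x ℕ.+ M C b)
    ≡⟨ cong₂ ℕ._+_ (ballot-C b (2 ℕ.+ g) M (M≡ b g)) (ballot-C (suc b) g M (M≡′ b g)) ⟩
  M C b ℕ.+ M C suc b                   ≡⟨ pascal M (suc b) ⟨
  N C suc b                             ∎
  where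
  open ≡-Reasoning
  x = ballot (suc b) g
  y = ballot b (2 ℕ.+ g)
  M = b ℕ.+ suc b ℕ.+ suc g
  M≡ : ∀ b g → b ℕ.+ suc b ℕ.+ suc g ≡ b ℕ.+ b ℕ.+ (2 ℕ.+ g)
  M≡ = solve-∀
  M≡′ : ∀ b g → b ℕ.+ suc b ℕ.+ suc g ≡ suc b ℕ.+ suc b ℕ.+ g
  M≡′ = solve-∀
  regroup : ∀ x y z w → x ℕ.+ y ℕ.+ (z ℕ.+ w) ≡ (y ℕ.+ z) ℕ.+ (x ℕ.+ w)
  regroup = solve-∀

-- By `ballot-C` the ballot number is a difference of two adjacent binomial coefficients, whose
-- ratio is given by `neighbour`. Adding `suc j * c` to both sides avoids subtraction.
suc*ballot≡C : ∀ k → suc k ℕ.* ballot k 0 ≡ (2 ℕ.* k) C k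
suc*ballot≡C zero    = refl
suc*ballot≡C (suc j) =
  ℕ.+-cancelʳ-≡ (suc j ℕ.* c) _ _ (begin
    (2 ℕ.+ j) ℕ.* ballot (suc j) 0 ℕ.+ suc j ℕ.* c
      ≡⟨ cong ((2 ℕ.+ j) ℕ.* ballot (suc j) 0 ℕ.+_) neighbour ⟨
    (2 ℕ.+ j) ℕ.* ballot (suc j) 0 ℕ.+ (2 ℕ.+ j) ℕ.* (N C j)
      ≡⟨ ℕ.*-distribˡ-+ (2 ℕ.+ j) (ballot (suc j) 0) (N C j) ⟨
    (2 ℕ.+ j) ℕ.* (ballot (suc j) 0 ℕ.+ N C j)
      ≡⟨ cong ((2 ℕ.+ j) ℕ.*_) (ballot-C (suc j) 0 N (N≡ j)) ⟩
    c ℕ.+ suc j ℕ.* c ∎)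
  where
  open ≡-Reasoning
  N = 2 ℕ.* suc j
  M = suc (j ℕ.+ j)
  c = N C suc j
  N≡ : ∀ j → 2 ℕ.* suc j ≡ suc j ℕ.+ suc j ℕ.+ 0
  N≡ = solve-∀
  N≡sucM : ∀ j → 2 ℕ.* suc j ≡ suc (suc (j ℕ.+ j))
  N≡sucM = solve-∀
  N≡j+[2+j] : ∀ j → 2 ℕ.* suc j ≡ j ℕ.+ (2 ℕ.+ j)
  N≡j+[2+j] = solve-∀
  -- After reflecting `N C j`, `absorption` turns both sides into `suc M` times one of the two equal
  -- middle entries of row `M`.
  neighbour : (2 ℕ.+ j) ℕ.* (N C j) ≡ suc j ℕ.* c
  neighbour = begin
    (2 ℕ.+ j) ℕ.* (N C j)
      ≡⟨ cong ((2 ℕ.+ j) ℕ.*_) (trans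
           (nCk≡nC[n∸k] (subst (j ≤_) (sym (N≡j+[2+j] j)) (ℕ.m≤m+n j _)))
           (cong (N C_) (trans (cong (_∸ j) (N≡j+[2+j] j)) (ℕ.m+n∸m≡n j _)))) ⟩
    (2 ℕ.+ j) ℕ.* (N C (2 ℕ.+ j))
      ≡⟨ cong (λ N → (2 ℕ.+ j) ℕ.* (N C (2 ℕ.+ j))) (N≡sucM j) ⟩
    (2 ℕ.+ j) ℕ.* (suc M C (2 ℕ.+ j))
      ≡⟨ absorption M (suc j) ⟩
    suc M ℕ.* (M C suc j)
      ≡⟨ cong (suc M ℕ.*_) (middle-C j) ⟨
    suc M ℕ.* (M C j)
      ≡⟨ absorption M j ⟨
    suc j ℕ.* (suc M C suc j)
      ≡⟨ cong (λ N → suc j ℕ.* (N C suc j)) (N≡sucM j) ⟨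
    suc j ℕ.* c ∎

ballot≡catalan : ∀ k → ballot k 0 ≡ catalan k
ballot≡catalan k = sym (begin
  ((2 ℕ.* k) C k) / suc k         ≡⟨ cong (_/ suc k) (suc*ballot≡C k) ⟨
  (suc k ℕ.* ballot k 0) / suc k  ≡⟨ cong (_/ suc k) (ℕ.*-comm (suc k) (ballot k 0)) ⟩
  (ballot k 0 ℕ.* suc k) / suc k  ≡⟨ m*n/n≡m (ballot k 0) (suc k) ⟩
  ballot k 0                      ∎)
  where open ≡-Reasoning

-- The stack machine and its signed enumeration

-- Entry t holds the value at position t and, if t is the northeast endpoint of
-- a hook, the southwest endpoint of that hook.
Trace : Set
Trace = List (ℕ × Maybe ℕ)

-- The largest skipped value is on top: two values in increasing order after a larger one would form
-- a 312, so skipped values must return in decreasing order.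
pushes : ℕ → ℕ → List ℕ → List ℕ
pushes m zero    st = st
pushes m (suc p) st = m ℕ.+ p ∷ pushes m p st

-- In the state (b , hk , st , m , t), position t comes next, b descents lie ahead,
-- hk lists the open hooks and st the skipped values below m, both with the most
-- recent one first.  Any K ≥ 3k loses no configuration with k hooks.
traces bottoms matched unmatched : (K b : ℕ) (hk st : List ℕ) (m t : ℕ) → List Trace
finish : ℕ → List ℕ → List ℕ → List Trace

traces K b hk st m t =
  finish b hk st ++ bottoms K b hk st m t ++ matched K b hk st m t ++ unmatched K b hk st m t

finish zero    []      []      = [] ∷ []
finish zero    []      (_ ∷ _) = []
finish zero    (_ ∷ _) _       = []
finish (suc _) _       _       = []

bottoms K zero    hk st       m t = []
bottoms K (suc b) hk []       m t = []
bottoms K (suc b) hk (x ∷ st) m t =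
  -- A hook is opened when its descent bottom is read, so its southwest endpoint is the preceding
  -- position.
  map ((x , nothing) ∷_) (traces K b (pred t ∷ hk) st m (suc t))

matched K b []       st m t = []
matched K b (i ∷ hk) st m t = concatMap
  (λ p → map ((m ℕ.+ p , just i) ∷_) (traces K b hk (pushes m p st) (suc (m ℕ.+ p)) (suc t)))
  (upTo K)

unmatched K b hk st m t = concatMap
  -- A new maximum is no descent bottom. If it ends no hook either, reducedness makes it a descent
  -- top, so a bottom must follow.
  (λ p → map ((m ℕ.+ p , nothing) ∷_) (bottoms K b hk (pushes m p st) (suc (m ℕ.+ p)) (suc t)))
  (upTo K)

sgn : ℕ → ℤ
sgn zero    = 1ℤ
sgn (suc n) = - sgn n

signedSum : List Trace → ℤ
signedSum []      = 0ℤ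
signedSum (w ∷ L) = sgn (length w) ℤ.+ signedSum L

signedSum-++ : ∀ L M → signedSum (L ++ M) ≡ signedSum L ℤ.+ signedSum M
signedSum-++ []      M = sym (ℤ.+-identityˡ _)
signedSum-++ (w ∷ L) M =
  trans (cong (λ z → sgn (length w) ℤ.+ z) (signedSum-++ L M))
        (sym (ℤ.+-assoc (sgn (length w)) (signedSum L) (signedSum M)))

signedSum-map : ∀ x L → signedSum (map (x ∷_) L) ≡ - signedSum L
signedSum-map x []      = refl
signedSum-map x (w ∷ L) =
  trans (cong (λ z → - sgn (length w) ℤ.+ z) (signedSum-map x L))
        (sym (ℤ.neg-distrib-+ (sgn (length w)) _))

signedSum-concatMap-0 : ∀ (F : ℕ → List Trace) (g : ℕ → ℕ) n → (∀ p → signedSum (F (g p)) ≡ 0ℤ) →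
                        signedSum (concatMap F (applyUpTo g n)) ≡ 0ℤ
signedSum-concatMap-0 F g zero    F≡0 = refl
signedSum-concatMap-0 F g (suc n) F≡0 = trans
  (signedSum-++ (F (g 0)) _)
  (cong₂ ℤ._+_ (F≡0 0) (signedSum-concatMap-0 F (g ∘ suc) n (F≡0 ∘ suc)))

-- Only p = 0 and p = 1 can contribute: with more skipped values at least one is left on the stack
-- even after a pop, and such states have signed sum 0. Hence the cutoff need only be at least 2.
signedSum-concatMap : ∀ (F : ℕ → List Trace) n → (∀ p → signedSum (F (2 ℕ.+ p)) ≡ 0ℤ) →
  signedSum (concatMap F (upTo (2 ℕ.+ n))) ≡ signedSum (F 0) ℤ.+ signedSum (F 1)
signedSum-concatMap F n F≡0 = trans
  (signedSum-++ (F 0) _)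
  (cong (λ z → signedSum (F 0) ℤ.+ z) (trans
    (signedSum-++ (F 1) _)
    (trans (cong (λ z → signedSum (F 1) ℤ.+ z) (signedSum-concatMap-0 F (suc ∘ suc) n F≡0))
           (ℤ.+-identityʳ _))))

-- The surviving continuations consist of `b` openings of two points each and `b + g` closings of
-- one point each, which gives the sign.
weight : ℕ → ℕ → List ℕ → ℤ
weight b g []      = sgn (b ℕ.+ g) ℤ.* + ballot b g
weight b g (_ ∷ _) = 0ℤ

bottomWeight : ℕ → ℕ → List ℕ → ℤ
bottomWeight zero    g _        = 0ℤ
bottomWeight (suc b) g []       = 0ℤ
bottomWeight (suc b) g (_ ∷ st) = - weight b (suc g) st

module _ (n : ℕ) where

  2+n : ℕ
  2+n = 2 ℕ.+ n

  signedSum-traces : ∀ b hk st m t →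
    signedSum (traces 2+n b hk st m t) ≡ weight b (length hk) st
  signedSum-bottoms : ∀ b hk st m t →
    signedSum (bottoms 2+n b hk st m t) ≡ bottomWeight b (length hk) st
  signedSum-matched : ∀ b i hk st m t →
    signedSum (matched 2+n b (i ∷ hk) st m t) ≡ - weight b (length hk) st
  signedSum-unmatched : ∀ b hk st m t →
    signedSum (unmatched 2+n b hk st m t) ≡
    - bottomWeight b (length hk) st ℤ.+ - bottomWeight b (length hk) (m ℕ.+ 0 ∷ st)

  signedSum-bottoms zero    hk st       m t = refl
  signedSum-bottoms (suc b) hk []       m t = refl
  signedSum-bottoms (suc b) hk (x ∷ st) m t = trans
    (signedSum-map (x , nothing) (traces 2+n b (pred t ∷ hk) st m (suc t)))
    (cong -_ (signedSum-traces b (pred t ∷ hk) st m (suc t)))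

  signedSum-matched b i hk st m t = trans
    (signedSum-concatMap F n (λ p → F-weight (2 ℕ.+ p)))
    (trans (cong₂ ℤ._+_ (F-weight 0) (F-weight 1)) (ℤ.+-identityʳ _))
    where
    F = λ p → map ((m ℕ.+ p , just i) ∷_) (traces 2+n b hk (pushes m p st) (suc (m ℕ.+ p)) (suc t))
    F-weight : ∀ p → signedSum (F p) ≡ - weight b (length hk) (pushes m p st)
    F-weight p = trans
      (signedSum-map (m ℕ.+ p , just i) (traces 2+n b hk (pushes m p st) (suc (m ℕ.+ p)) (suc t)))
      (cong -_ (signedSum-traces b hk (pushes m p st) (suc (m ℕ.+ p)) (suc t)))

  signedSum-unmatched b hk st m t = trans
    (signedSum-concatMap F n (λ p → trans (F-weight (2 ℕ.+ p)) (vanish b p)))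
    (cong₂ ℤ._+_ (F-weight 0) (F-weight 1))
    where
    F = λ p → map ((m ℕ.+ p , nothing) ∷_)
                  (bottoms 2+n b hk (pushes m p st) (suc (m ℕ.+ p)) (suc t))
    F-weight : ∀ p → signedSum (F p) ≡ - bottomWeight b (length hk) (pushes m p st)
    F-weight p = trans
      (signedSum-map (m ℕ.+ p , nothing) (bottoms 2+n b hk (pushes m p st) (suc (m ℕ.+ p)) (suc t)))
      (cong -_ (signedSum-bottoms b hk (pushes m p st) (suc (m ℕ.+ p)) (suc t)))
    vanish : ∀ b p → - bottomWeight b (length hk) (pushes m (2 ℕ.+ p) st) ≡ 0ℤ
    vanish zero    p = refl
    vanish (suc b) p = refl

  signedSum-traces b hk st m t = trans
    (trans (signedSum-++ (finish b hk st) _)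
      (cong (λ z → signedSum (finish b hk st) ℤ.+ z) (trans (signedSum-++ (bottoms 2+n b hk st m t) _)
        (cong₂ ℤ._+_ (signedSum-bottoms b hk st m t) (trans (signedSum-++ (matched 2+n b hk st m t) _)
          (cong (λ z → signedSum (matched 2+n b hk st m t) ℤ.+ z) (signedSum-unmatched b hk st m t)))))))
    (total b hk st)
    where
    -- The bottom step and an unmatched new maximum with p = 0 cancel.
    cancel : ∀ V → 0ℤ ℤ.+ (- V ℤ.+ (0ℤ ℤ.+ (- (- V) ℤ.+ 0ℤ))) ≡ 0ℤ
    cancel = solveℤ-∀
    total : ∀ b hk st →
      signedSum (finish b hk st) ℤ.+ (bottomWeight b (length hk) st ℤ.+
        (signedSum (matched 2+n b hk st m t) ℤ.+
          (- bottomWeight b (length hk) st ℤ.+ - bottomWeight b (length hk) (m ℕ.+ 0 ∷ st))))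
      ≡ weight b (length hk) st
    total zero    []       []       = refl
    total zero    []       (x ∷ st) = refl
    total zero    (i ∷ hk) []       = trans
      (cong (λ z → 0ℤ ℤ.+ (0ℤ ℤ.+ (z ℤ.+ 0ℤ))) (signedSum-matched zero i hk [] m t))
      (lem (sgn (length hk)) (+ ballot 0 (length hk)))
      where
      lem : ∀ s c → 0ℤ ℤ.+ (0ℤ ℤ.+ (- (s ℤ.* c) ℤ.+ 0ℤ)) ≡ - s ℤ.* c
      lem = solveℤ-∀
    total zero    (i ∷ hk) (x ∷ st) =
      cong (λ z → 0ℤ ℤ.+ (0ℤ ℤ.+ (z ℤ.+ 0ℤ))) (signedSum-matched zero i hk (x ∷ st) m t)
    -- With both stacks empty only the opening with one skipped value is left, matching the single
    -- term of `ballot (suc b) zero`.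
    total (suc b) []       []       = trans
      (lem (sgn (b ℕ.+ 1)) (+ ballot b 1))
      (cong (λ l → sgn l ℤ.* + ballot b 1) (trans (ℕ.+-suc b 0) refl))
      where
      lem : ∀ s c → 0ℤ ℤ.+ (0ℤ ℤ.+ (0ℤ ℤ.+ (0ℤ ℤ.+ - (- (s ℤ.* c))))) ≡ s ℤ.* c
      lem = solveℤ-∀
    total (suc b) []       (x ∷ st) = cancel (weight b 1 st)
    -- Closing changes the sign of the length and the parity of `b + g` together; opening changes
    -- neither. So both survivors carry the same sign and add up as in the recurrence of `ballot`.
    total (suc b) (i ∷ hk) []       = trans
      (cong (λ z → 0ℤ ℤ.+ (0ℤ ℤ.+ (z ℤ.+ (0ℤ ℤ.+ - (- (sgn (b ℕ.+ (2 ℕ.+ g)) ℤ.* y))))))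
            (signedSum-matched (suc b) i hk [] m t))
      (trans (cong (λ s → 0ℤ ℤ.+ (0ℤ ℤ.+ (- (- sgn (b ℕ.+ g) ℤ.* x) ℤ.+ (0ℤ ℤ.+ - (- (s ℤ.* y))))))
                   (trans (cong sgn (trans (ℕ.+-suc b (suc g)) (cong suc (ℕ.+-suc b g))))
                          (ℤ.neg-involutive (sgn (b ℕ.+ g)))))
        (trans (lem (sgn (b ℕ.+ g)) x y)
               (cong₂ ℤ._*_ (sym (trans (cong (-_ ∘ sgn) (ℕ.+-suc b g)) (ℤ.neg-involutive _)))
                            (sym (ℤ.pos-+ (ballot (suc b) g) _)))))
      where
      g = length hk
      x = + ballot (suc b) g
      y = + ballot b (2 ℕ.+ g)
      lem : ∀ s x y → 0ℤ ℤ.+ (0ℤ ℤ.+ (- (- s ℤ.* x) ℤ.+ (0ℤ ℤ.+ - (- (s ℤ.* y))))) ≡ s ℤ.* (x ℤ.+ y)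
      lem = solveℤ-∀
    total (suc b) (i ∷ hk) (x ∷ st) = trans
      (cong (λ z → 0ℤ ℤ.+ (- V ℤ.+ (z ℤ.+ (- (- V) ℤ.+ 0ℤ))))
            (signedSum-matched (suc b) i hk (x ∷ st) m t))
      (cancel V)
      where V = weight b (2 ℕ.+ length hk) st

-- From the signed sum over traces to the alternating sum over lengths

sgn-+ : ∀ m n → sgn (m ℕ.+ n) ≡ sgn m ℤ.* sgn n
sgn-+ zero    n = sym (ℤ.*-identityˡ _)
sgn-+ (suc m) n = trans (cong -_ (sgn-+ m n)) (ℤ.neg-distribˡ-* (sgn m) (sgn n))

sgn-square : ∀ n → sgn n ℤ.* sgn n ≡ 1ℤ
sgn-square zero    = refl
sgn-square (suc n) = trans (sym (ℤ.neg-distribˡ-* (sgn n) (- sgn n)))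
  (trans (cong -_ (sym (ℤ.neg-distribʳ-* (sgn n) (sgn n))))
         (trans (ℤ.neg-involutive _) (sgn-square n)))

^≡sgn : ∀ n → (- 1ℤ) ℤ.^ n ≡ sgn n
^≡sgn zero    = refl
^≡sgn (suc n) = trans (cong (- 1ℤ ℤ.*_) (^≡sgn n)) (ℤ.-1*i≡-i (sgn n))

sum-single : ∀ {n} (t : Fin n → ℤ) j → (∀ i → i ≢ j → t i ≡ 0ℤ) → sum t ≡ t j
sum-single {suc n} t Fin.zero    t≡0 = trans
  (cong (λ z → t Fin.zero ℤ.+ z)
        (trans (sum-cong-≗ (λ i → t≡0 (Fin.suc i) (λ ()))) (sum-replicate-zero n)))
  (ℤ.+-identityʳ _)
sum-single {suc n} t (Fin.suc j) t≡0 = trans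
  (cong₂ ℤ._+_ (t≡0 Fin.zero (λ ()))
               (sum-single (t ∘ Fin.suc) j (λ i i≢j → t≡0 (Fin.suc i) (i≢j ∘ Fin.suc-injective))))
  (ℤ.+-identityˡ _)

ofLength : ℕ → List Trace → List Trace
ofLength l = filter (λ w → length w ℕ.≟ l)

length-ofLength-≡ : ∀ {l} w → length w ≡ l → length (ofLength l (w ∷ [])) ≡ 1
length-ofLength-≡ {l} w eq = cong length (List.filter-accept (λ w → length w ℕ.≟ l) {w} {[]} eq)

length-ofLength-≢ : ∀ {l} w → length w ≢ l → length (ofLength l (w ∷ [])) ≡ 0
length-ofLength-≢ {l} w neq = cong length (List.filter-reject (λ w → length w ℕ.≟ l) {w} {[]} neq)

module _ (k : ℕ) where

  term : List Trace → Fin k → ℤ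
  term L i = (- 1ℤ) ℤ.^ toℕ i ℤ.* + length (ofLength (3 ℕ.* k ∸ toℕ i) L)

  term-∷ : ∀ w L i → term (w ∷ L) i ≡ term (w ∷ []) i ℤ.+ term L i
  term-∷ w L i = trans
    (cong (λ z → (- 1ℤ) ℤ.^ toℕ i ℤ.* + z) split)
    (trans (cong ((- 1ℤ) ℤ.^ toℕ i ℤ.*_) (ℤ.pos-+ (length (ofLength l (w ∷ []))) (length (ofLength l L))))
           (ℤ.*-distribˡ-+ ((- 1ℤ) ℤ.^ toℕ i) _ _))
    where
    l = 3 ℕ.* k ∸ toℕ i
    split : length (ofLength l (w ∷ L)) ≡ length (ofLength l (w ∷ [])) ℕ.+ length (ofLength l L)
    split with length w ℕ.≡ᵇ l
    ... | true  = refl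
    ... | false = refl

  -- A trace is counted only at the index i = 3k - `length w`, and the two bounds on its length say
  -- exactly that 0 ≤ i < k.
  sum-term-singleton : ∀ w → 2 ℕ.* k < length w → length w ≤ 3 ℕ.* k →
                       sum (term (w ∷ [])) ≡ sgn k ℤ.* sgn (length w)
  sum-term-singleton w 2k<w w≤3k = trans
    (sum-single (term (w ∷ [])) (fromℕ< j<k) other)
    (trans (cong₂ (λ x y → x ℤ.* + y) (trans (^≡sgn (toℕ (fromℕ< j<k))) (cong sgn toℕ-j)) hit)
           (trans (ℤ.*-identityʳ (sgn j)) sgn-j))
    where
    j = 3 ℕ.* k ∸ length w
    j+w : j ℕ.+ length w ≡ 3 ℕ.* k
    j+w = ℕ.m∸n+n≡m w≤3k
    3k≡ : ∀ k → 3 ℕ.* k ≡ k ℕ.+ 2 ℕ.* k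
    3k≡ = solve-∀
    j<k : j < k
    j<k = ℕ.+-cancelʳ-< (length w) j k
      (subst (_< k ℕ.+ length w) (sym (trans j+w (3k≡ k))) (ℕ.+-monoʳ-< k 2k<w))
    toℕ-j : toℕ (fromℕ< j<k) ≡ j
    toℕ-j = Fin.toℕ-fromℕ< j<k
    w≡3k∸j : length w ≡ 3 ℕ.* k ∸ j
    w≡3k∸j = sym (ℕ.m∸[m∸n]≡n w≤3k)
    hit : length (ofLength (3 ℕ.* k ∸ toℕ (fromℕ< j<k)) (w ∷ [])) ≡ 1
    hit = length-ofLength-≡ w (
      (trans w≡3k∸j (cong (3 ℕ.* k ∸_) (sym toℕ-j))))
    other : ∀ i → i ≢ fromℕ< j<k → term (w ∷ []) i ≡ 0ℤ
    other i i≢j = trans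
      (cong (λ l → (- 1ℤ) ℤ.^ toℕ i ℤ.* + l) (length-ofLength-≢ w miss))
      (ℤ.*-zeroʳ ((- 1ℤ) ℤ.^ toℕ i))
      where
      miss : length w ≢ 3 ℕ.* k ∸ toℕ i
      miss eq = i≢j (Fin.toℕ-injective (trans
        (ℕ.∸-cancelˡ-≡ (ℕ.≤-trans (ℕ.<⇒≤ (Fin.toℕ<n i)) (ℕ.m≤n*m k 3))
                       (ℕ.m∸n≤m (3 ℕ.* k) (length w)) (trans (sym eq) w≡3k∸j))
        (sym toℕ-j)))
    -- The sum is 4k, so `j` and `k + length w` have the same parity.
    even : j ℕ.+ (k ℕ.+ length w) ≡ 2 ℕ.* k ℕ.+ 2 ℕ.* k
    even = trans (regroup j k (length w)) (trans (cong (k ℕ.+_) j+w) (4k≡ k))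
      where
      regroup : ∀ j k l → j ℕ.+ (k ℕ.+ l) ≡ k ℕ.+ (j ℕ.+ l)
      regroup = solve-∀
      4k≡ : ∀ k → k ℕ.+ 3 ℕ.* k ≡ 2 ℕ.* k ℕ.+ 2 ℕ.* k
      4k≡ = solve-∀
    sgn-j : sgn j ≡ sgn k ℤ.* sgn (length w)
    sgn-j = begin
      sgn j                                          ≡⟨ ℤ.*-identityʳ _ ⟨
      sgn j ℤ.* 1ℤ                                   ≡⟨ cong (sgn j ℤ.*_) (sgn-square (k ℕ.+ length w)) ⟨
      sgn j ℤ.* (s ℤ.* s)                            ≡⟨ ℤ.*-assoc (sgn j) s s ⟨
      sgn j ℤ.* s ℤ.* s                              ≡⟨ cong (ℤ._* s) (sgn-+ j _) ⟨
      sgn (j ℕ.+ (k ℕ.+ length w)) ℤ.* s             ≡⟨ cong (λ l → sgn l ℤ.* s) even ⟩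
      sgn (2 ℕ.* k ℕ.+ 2 ℕ.* k) ℤ.* s
        ≡⟨ cong (ℤ._* s) (trans (sgn-+ (2 ℕ.* k) (2 ℕ.* k)) (sgn-square (2 ℕ.* k))) ⟩
      1ℤ ℤ.* s                                       ≡⟨ ℤ.*-identityˡ s ⟩
      s                                              ≡⟨ sgn-+ k (length w) ⟩
      sgn k ℤ.* sgn (length w)                       ∎
      where
      open ≡-Reasoning
      s = sgn (k ℕ.+ length w)

  sum-term : ∀ L → All (λ w → 2 ℕ.* k < length w × length w ≤ 3 ℕ.* k) L →
             sum (term L) ≡ sgn k ℤ.* signedSum L
  sum-term []      []                    = trans
    (trans (sum-cong-≗ {k} (λ i → ℤ.*-zeroʳ ((- 1ℤ) ℤ.^ toℕ i))) (sum-replicate-zero k))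
    (sym (ℤ.*-zeroʳ (sgn k)))
  sum-term (w ∷ L) ((lo , hi) ∷ bounds) = begin
    sum (term (w ∷ L))                              ≡⟨ sum-cong-≗ (term-∷ w L) ⟩
    sum (λ i → term (w ∷ []) i ℤ.+ term L i)        ≡⟨ ∑-distrib-+ (term (w ∷ [])) (term L) ⟩
    sum (term (w ∷ [])) ℤ.+ sum (term L)
      ≡⟨ cong₂ ℤ._+_ (sum-term-singleton w lo hi) (sum-term L bounds) ⟩
    sgn k ℤ.* sgn (length w) ℤ.+ sgn k ℤ.* signedSum L
      ≡⟨ ℤ.*-distribˡ-+ (sgn k) (sgn (length w)) (signedSum L) ⟨
    sgn k ℤ.* signedSum (w ∷ L)                     ∎
    where open ≡-Reasoning

-- Runs of the machine

concatMap-unique : {A B : Set} (F : A → List B) {xs : List A} →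
  (∀ x → Unique (F x)) → (∀ {x y w} → w ∈ F x → w ∈ F y → x ≡ y) →
  Unique xs → Unique (concatMap F xs)
concatMap-unique F F! disjoint xs! = Unique.concat⁺
  (All.map⁺ (All.universal F! _))
  (AllPairs.map⁺ (AllPairs.map (λ x≢y → λ { (w∈x , w∈y) → x≢y (disjoint w∈x w∈y) }) xs!))

All<-pushes : ∀ {m st} p → All (_< m) st → All (_< m + p) (pushes m p st)
All<-pushes {m} {st} zero    st<m = subst (λ m → All (_< m) st) (sym (ℕ.+-identityʳ m)) st<m
All<-pushes {m} {st} (suc p) st<m = subst (λ l → All (_< l) (pushes m (suc p) st)) (sym (ℕ.+-suc m p))
  (ℕ.n<1+n _ ∷ All.map ℕ.m<n⇒m<1+n (All<-pushes p st<m))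

All<-suc-pushes : ∀ {m st} p → All (_< m) st → All (_< suc (m + p)) (pushes m p st)
All<-suc-pushes p st<m = All.map ℕ.m<n⇒m<1+n (All<-pushes p st<m)

module _ (K : ℕ) where

  ∈-bottoms : ∀ b hk st m t {w} → w ∈ bottoms K b hk st m t →
              ∃[ b′ ] ∃[ x ] ∃[ st′ ] ∃[ w′ ] (b ≡ suc b′ × st ≡ x ∷ st′ × w ≡ (x , nothing) ∷ w′ ×
                w′ ∈ traces K b′ (pred t ∷ hk) st′ m (suc t))
  ∈-bottoms (suc b) hk (x ∷ st) m t w∈ with w′ , w′∈ , eq ← ∈-map⁻ _ w∈ =
    b , x , st , w′ , refl , refl , eq , w′∈

  ∈-matched : ∀ b hk st m t {w} → w ∈ matched K b hk st m t →
              ∃[ i ] ∃[ hk′ ] ∃[ p ] ∃[ w′ ] (hk ≡ i ∷ hk′ × p < K × w ≡ (m + p , just i) ∷ w′ ×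
                w′ ∈ traces K b hk′ (pushes m p st) (suc (m + p)) (suc t))
  ∈-matched b (i ∷ hk) st m t w∈
    with p , p∈ , w∈p ← find (∈-concatMap⁻ _ {xs = upTo K} w∈)
    with w′ , w′∈ , eq ← ∈-map⁻ _ w∈p = i , hk , p , w′ , refl , ∈-upTo⁻ p∈ , eq , w′∈

  ∈-unmatched : ∀ b hk st m t {w} → w ∈ unmatched K b hk st m t →
                ∃[ p ] ∃[ w′ ] (p < K × w ≡ (m + p , nothing) ∷ w′ ×
                  w′ ∈ bottoms K b hk (pushes m p st) (suc (m + p)) (suc t))
  ∈-unmatched b hk st m t w∈
    with p , p∈ , w∈p ← find (∈-concatMap⁻ _ {xs = upTo K} w∈)
    with w′ , w′∈ , eq ← ∈-map⁻ _ w∈p = p , w′ , ∈-upTo⁻ p∈ , eq , w′∈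

  finish-unique : ∀ b hk st → Unique (finish b hk st)
  finish-unique zero    []       []       = [] ∷ []
  finish-unique zero    []       (x ∷ st) = []
  finish-unique zero    (i ∷ hk) st       = []
  finish-unique (suc b) hk       st       = []

  ∈-finish : ∀ b hk st {w} → w ∈ finish b hk st → b ≡ 0 × hk ≡ [] × st ≡ [] × w ≡ []
  ∈-finish zero [] [] (here eq) = refl , refl , refl , eq

  value-head : ∀ {m m′ x y} {w w′ : Trace} → (m , x) ∷ w ≡ (m′ , y) ∷ w′ → m ≡ m′
  value-head refl = refl

  partner-head : ∀ {m m′ x y} {w w′ : Trace} → (m , x) ∷ w ≡ (m′ , y) ∷ w′ → x ≡ y
  partner-head refl = refl

  same-rise : ∀ {m p q} {x : Maybe ℕ} {w : Trace} {L M : List Trace} →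
              w ∈ map ((m + p , x) ∷_) L → w ∈ map ((m + q , x) ∷_) M → p ≡ q
  same-rise {m} w∈ w∈′ with _ , _ , refl ← ∈-map⁻ _ w∈ | _ , _ , eq ← ∈-map⁻ _ w∈′ =
    ℕ.+-cancelˡ-≡ m _ _ (value-head eq)

  -- The first entry tells the kinds of step apart: a pop reads a value below `m`, a new maximum
  -- does not, and the partner shows whether a hook is closed. The hypothesis on `st` is what keeps
  -- pops below `m`.
  traces-unique : ∀ b hk st m t → All (_< m) st → Unique (traces K b hk st m t)
  bottoms-unique : ∀ b hk st m t → All (_< m) st → Unique (bottoms K b hk st m t)
  matched-unique : ∀ b hk st m t → All (_< m) st → Unique (matched K b hk st m t)
  unmatched-unique : ∀ b hk st m t → All (_< m) st → Unique (unmatched K b hk st m t)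

  bottoms-unique zero    hk st       m t st<m = []
  bottoms-unique (suc b) hk []       m t st<m = []
  bottoms-unique (suc b) hk (x ∷ st) m t (_ ∷ st<m) =
    Unique.map⁺ List.∷-injectiveʳ (traces-unique b (pred t ∷ hk) st m (suc t) st<m)

  matched-unique b []       st m t st<m = []
  matched-unique b (i ∷ hk) st m t st<m = concatMap-unique _
    (λ p → Unique.map⁺ List.∷-injectiveʳ
      (traces-unique b hk (pushes m p st) (suc (m + p)) (suc t) (All<-suc-pushes p st<m)))
    same-rise
    (Unique.upTo⁺ K)

  unmatched-unique b hk st m t st<m = concatMap-unique _
    (λ p → Unique.map⁺ List.∷-injectiveʳ
      (bottoms-unique b hk (pushes m p st) (suc (m + p)) (suc t) (All<-suc-pushes p st<m)))
    same-rise
    (Unique.upTo⁺ K)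

  traces-unique b hk st m t st<m =
    Unique.++⁺ (finish-unique b hk st)
      (Unique.++⁺ (bottoms-unique b hk st m t st<m)
        (Unique.++⁺ (matched-unique b hk st m t st<m) (unmatched-unique b hk st m t st<m)
          matched#unmatched)
        bottoms#rest)
      finish#rest
    where
    matched#unmatched : ∀ {w} → w ∈ matched K b hk st m t × w ∈ unmatched K b hk st m t → _
    matched#unmatched (w∈ , w∈′)
      with _ , _ , _ , _ , _ , _ , refl , _ ← ∈-matched b hk st m t w∈
      with _ , _ , _ , eq , _ ← ∈-unmatched b hk st m t w∈′
      with () ← partner-head eq
    m≢ : ∀ {x xs} p → All (_< m) (x ∷ xs) → x ≢ m + p
    m≢ p (x<m ∷ _) x≡m+p = ℕ.<⇒≢ (ℕ.≤-trans x<m (ℕ.m≤m+n m p)) x≡m+p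
    bottoms#rest : ∀ {w} → w ∈ bottoms K b hk st m t ×
                   w ∈ matched K b hk st m t ++ unmatched K b hk st m t → _
    bottoms#rest (w∈ , w∈′)
      with _ , _ , _ , _ , refl , refl , refl , _ ← ∈-bottoms b hk st m t w∈
      with ∈-++⁻ (matched K b hk st m t) w∈′
    ... | inj₁ w∈″ with _ , _ , p , _ , _ , _ , eq , _ ← ∈-matched b hk st m t w∈″ =
      m≢ p st<m (value-head eq)
    ... | inj₂ w∈″ with p , _ , _ , eq , _ ← ∈-unmatched b hk st m t w∈″ =
      m≢ p st<m (value-head eq)
    finish#rest : ∀ {w} → w ∈ finish b hk st × w ∈ bottoms K b hk st m t ++
                  matched K b hk st m t ++ unmatched K b hk st m t → _
    finish#rest (w∈ , w∈′)
      with _ , _ , _ , refl ← ∈-finish b hk st w∈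
      with ∈-++⁻ (bottoms K b hk st m t) w∈′
    ... | inj₁ w∈″ with _ , _ , _ , _ , _ , _ , () , _ ← ∈-bottoms b hk st m t w∈″
    ... | inj₂ w∈″ with ∈-++⁻ (matched K b hk st m t) w∈″
    ...   | inj₁ w∈‴ with _ , _ , _ , _ , _ , _ , () , _ ← ∈-matched b hk st m t w∈‴
    ...   | inj₂ w∈‴ with _ , _ , _ , () , _ ← ∈-unmatched b hk st m t w∈‴

-- Traces as functions of the position

segment : (ℕ → ℕ) → (ℕ → Maybe ℕ) → ℕ → ℕ → Trace
segment v e t zero    = []
segment v e t (suc r) = (v t , e t) ∷ segment v e (suc t) r

valueAt : Trace → ℕ → ℕ
valueAt []            t       = 0
valueAt ((x , _) ∷ w) zero    = x
valueAt (_ ∷ w)       (suc t) = valueAt w t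

partnerAt : Trace → ℕ → Maybe ℕ
partnerAt []            t       = nothing
partnerAt ((_ , y) ∷ w) zero    = y
partnerAt (_ ∷ w)       (suc t) = partnerAt w t

segment-suc : ∀ v e t r → segment v e (suc t) r ≡ segment (v ∘ suc) (e ∘ suc) t r
segment-suc v e t zero    = refl
segment-suc v e t (suc r) = cong (_ ∷_) (segment-suc v e (suc t) r)

segment-lookup : ∀ w → segment (valueAt w) (partnerAt w) 0 (length w) ≡ w
segment-lookup []      = refl
segment-lookup (x ∷ w) = cong (x ∷_)
  (trans (segment-suc (valueAt (x ∷ w)) (partnerAt (x ∷ w)) 0 (length w)) (segment-lookup w))

module Machine (K n : ℕ) (v : ℕ → ℕ) (e : ℕ → Maybe ℕ) where

  -- Membership in `traces` as an inductive family over fixed functions `v` and `e`, so that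
  -- invariants can be proved by induction on steps. `Bottom` stands for `bottoms`, and `end` fixes
  -- the length.
  data Run : (b : ℕ) (hk st : List ℕ) (m t : ℕ) → Set
  data Bottom : (b : ℕ) (hk st : List ℕ) (m t : ℕ) → Set

  data Run where
    end       : ∀ {m t} → t ≡ n → Run 0 [] [] m t
    drop      : ∀ {b hk st m t} → Bottom b hk st m t → Run b hk st m t
    close     : ∀ {b i hk st m t} p → p < K → v t ≡ m + p → e t ≡ just i →
                Run b hk (pushes m p st) (suc (m + p)) (suc t) → Run b (i ∷ hk) st m t
    rise      : ∀ {b hk st m t} p → p < K → v t ≡ m + p → e t ≡ nothing →
                Bottom b hk (pushes m p st) (suc (m + p)) (suc t) → Run b hk st m t

  data Bottom where
    pop : ∀ {b hk x st m t} → v t ≡ x → e t ≡ nothing →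
          Run b (pred t ∷ hk) st m (suc t) → Bottom (suc b) hk (x ∷ st) m t

  ∈-segment : ∀ t r {x y L} → v t ≡ x → e t ≡ y → segment v e (suc t) r ∈ L →
              segment v e t (suc r) ∈ map ((x , y) ∷_) L
  ∈-segment t r refl refl w∈ = ∈-map⁺ _ w∈

  Run⇒∈ : ∀ {b hk st m t} → Run b hk st m t →
          ∃[ r ] (t + r ≡ n × segment v e t r ∈ traces K b hk st m t)
  Bottom⇒∈ : ∀ {b hk st m t} → Bottom b hk st m t →
             ∃[ r ] (t + r ≡ n × segment v e t r ∈ bottoms K b hk st m t)
  Run⇒∈ {t = t} (end t≡n) = 0 , trans (ℕ.+-identityʳ t) t≡n , here refl
  Run⇒∈ {b} {hk} {st} {m} {t} (drop B) with r , t+r , w∈ ← Bottom⇒∈ B =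
    r , t+r , ∈-++⁺ʳ (finish b hk st) (∈-++⁺ˡ w∈)
  Run⇒∈ {b} {i ∷ hk} {st} {m} {t} (close p p<K vt et R) with r , t+r , w∈ ← Run⇒∈ R =
    suc r , trans (ℕ.+-suc t r) t+r ,
    ∈-++⁺ʳ (finish b (i ∷ hk) st) (∈-++⁺ʳ (bottoms K b (i ∷ hk) st m t) (∈-++⁺ˡ
      (∈-concatMap⁺ _ (lose (∈-upTo⁺ p<K) (∈-segment t r vt et w∈)))))
  Run⇒∈ {b} {hk} {st} {m} {t} (rise p p<K vt et B) with r , t+r , w∈ ← Bottom⇒∈ B =
    suc r , trans (ℕ.+-suc t r) t+r ,
    ∈-++⁺ʳ (finish b hk st) (∈-++⁺ʳ (bottoms K b hk st m t) (∈-++⁺ʳ (matched K b hk st m t)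
      (∈-concatMap⁺ _ (lose (∈-upTo⁺ p<K) (∈-segment t r vt et w∈)))))
  Bottom⇒∈ {t = t} (pop {x = x} vt et R) with r , t+r , w∈ ← Run⇒∈ R =
    suc r , trans (ℕ.+-suc t r) t+r ,
    ∈-segment t r vt et w∈

  segment-∷ : ∀ t r {x y w} → segment v e t r ≡ (x , y) ∷ w →
              ∃[ r′ ] (r ≡ suc r′ × v t ≡ x × e t ≡ y × segment v e (suc t) r′ ≡ w)
  segment-∷ t (suc r) refl = r , refl , refl , refl , refl

  ∈⇒Run : ∀ r {b hk st m t} → t + r ≡ n → segment v e t r ∈ traces K b hk st m t → Run b hk st m t
  ∈⇒Bottom : ∀ r {b hk st m t} → t + r ≡ n → segment v e t r ∈ bottoms K b hk st m t →
             Bottom b hk st m t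
  ∈⇒Bottom r {b} {hk} {st} {m} {t} t+r w∈
    with b′ , x , st′ , w′ , refl , refl , eq , w′∈ ← ∈-bottoms K b hk st m t w∈
    with r′ , refl , vt , et , refl ← segment-∷ t r eq =
    pop vt et (∈⇒Run r′ (trans (sym (ℕ.+-suc t r′)) t+r) w′∈)
  ∈⇒Run r {b} {hk} {st} {m} {t} t+r w∈ with ∈-++⁻ (finish b hk st) w∈
  ... | inj₁ w∈′ with refl , refl , refl , eq ← ∈-finish K b hk st w∈′ =
    end (t≡n r eq t+r)
    where
    t≡n : ∀ r → segment v e t r ≡ [] → t + r ≡ n → t ≡ n
    t≡n zero refl t+0 = trans (sym (ℕ.+-identityʳ t)) t+0
  ... | inj₂ w∈′ with ∈-++⁻ (bottoms K b hk st m t) w∈′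
  ...   | inj₁ w∈″ = drop (∈⇒Bottom r t+r w∈″)
  ...   | inj₂ w∈″ with ∈-++⁻ (matched K b hk st m t) w∈″
  ...     | inj₁ w∈‴
              with i , hk′ , p , w′ , refl , p<K , eq , w′∈ ← ∈-matched K b hk st m t w∈‴
              with r′ , refl , vt , et , refl ← segment-∷ t r eq =
              close p p<K vt et (∈⇒Run r′ (trans (sym (ℕ.+-suc t r′)) t+r) w′∈)
  ...     | inj₂ w∈‴
              with p , w′ , p<K , eq , w′∈ ← ∈-unmatched K b hk st m t w∈‴
              with r′ , refl , vt , et , refl ← segment-∷ t r eq =
              rise p p<K vt et (∈⇒Bottom r′ (trans (sym (ℕ.+-suc t r′)) t+r) w′∈)

  -- Each descent ahead still costs its bottom and the end of its hook, and each open hook costs its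
  -- end.
  Run-lower : ∀ {b hk st m t} → Run b hk st m t → 2 ℕ.* b + (length hk + t) ≤ n
  Bottom-lower : ∀ {b hk st m t} → Bottom b hk st m t → 2 ℕ.* b + (length hk + t) ≤ n
  Run-lower (end refl) = ℕ.≤-refl
  Run-lower (drop B) = Bottom-lower B
  Run-lower {b} {i ∷ hk} {t = t} (close p _ _ _ R) =
    subst (λ l → 2 ℕ.* b + l ≤ n) (ℕ.+-suc (length hk) t) (Run-lower R)
  Run-lower {b} {hk} {t = t} (rise p _ _ _ B) = ℕ.≤-trans
    (ℕ.+-monoʳ-≤ (2 ℕ.* b) (ℕ.+-monoʳ-≤ (length hk) (ℕ.n≤1+n t))) (Bottom-lower B)
  Bottom-lower {suc b} {hk} {t = t} (pop _ _ R) = subst (_≤ n) (lem b (length hk) t) (Run-lower R)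
    where
    lem : ∀ b g t → 2 ℕ.* b + (suc g + suc t) ≡ 2 ℕ.* suc b + (g + t)
    lem = solve-∀

  -- A descent costs at most one further point, an unmatched maximum as its top. `Bottom-upper` is
  -- strict because the next bottom comes at once, without such a maximum before it.
  Run-upper : ∀ {b hk st m t} → Run b hk st m t → n ≤ 3 ℕ.* b + (length hk + t)
  Bottom-upper : ∀ {b hk st m t} → Bottom b hk st m t → n < 3 ℕ.* b + (length hk + t)
  Run-upper (end refl) = ℕ.≤-refl
  Run-upper (drop B) = ℕ.<⇒≤ (Bottom-upper B)
  Run-upper {b} {i ∷ hk} {t = t} (close p _ _ _ R) =
    subst (λ l → n ≤ 3 ℕ.* b + l) (ℕ.+-suc (length hk) t) (Run-upper R)
  Run-upper {b} {hk} {t = t} (rise p _ _ _ B) =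
    ℕ.s≤s⁻¹ (subst (n <_) (lem (3 ℕ.* b) (length hk) t) (Bottom-upper B))
    where
    lem : ∀ b g t → b + (g + suc t) ≡ suc (b + (g + t))
    lem = solve-∀
  Bottom-upper {suc b} {hk} {t = t} (pop _ _ R) =
    subst (n <_) (lem b (length hk) t) (s≤s (Run-upper R))
    where
    lem : ∀ b g t → suc (3 ℕ.* b + (suc g + suc t)) ≡ 3 ℕ.* suc b + (g + t)
    lem = solve-∀

trace-length : ∀ K k {w} → w ∈ traces K (suc k) [] [] 0 0 →
               2 ℕ.* suc k < length w × length w ≤ 3 ℕ.* suc k
trace-length K k {w} w∈ = lower run , subst (length w ≤_) (ℕ.+-identityʳ _) (Run-upper run)
  where
  open Machine K (length w) (valueAt w) (partnerAt w)
  run : Run (suc k) [] [] 0 0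
  run = ∈⇒Run (length w) refl (subst (_∈ _) (sym (segment-lookup w)) w∈)
  lower : Run (suc k) [] [] 0 0 → 2 ℕ.* suc k < length w
  -- With both stacks empty and a descent ahead, no other step is possible; this unmatched maximum
  -- makes the lower bound strict.
  lower (rise p _ _ _ B) = subst (_≤ length w) (ℕ.+-comm (2 ℕ.* suc k) 1) (Bottom-lower B)

-- Runs and configurations

module _ {m : ℕ} {st : List ℕ} where

  ∈-pushes⁻ : ∀ p {y} → y ∈ pushes m p st → (m ≤ y × y < m + p) ⊎ y ∈ st
  ∈-pushes⁻ zero    y∈          = inj₂ y∈
  ∈-pushes⁻ (suc p) (here refl) = inj₁ (ℕ.m≤m+n m p , ℕ.+-monoʳ-< m (ℕ.n<1+n p))
  ∈-pushes⁻ (suc p) (there y∈)  =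
    Sum.map₁ (λ (m≤y , y<) → m≤y , ℕ.<-trans y< (ℕ.+-monoʳ-< m (ℕ.n<1+n p))) (∈-pushes⁻ p y∈)

  ∈-pushes⁺ʳ : ∀ p {y} → y ∈ st → y ∈ pushes m p st
  ∈-pushes⁺ʳ zero    y∈ = y∈
  ∈-pushes⁺ʳ (suc p) y∈ = there (∈-pushes⁺ʳ p y∈)

  ∈-pushes⁺ˡ : ∀ p {y} → m ≤ y → y < m + p → y ∈ pushes m p st
  ∈-pushes⁺ˡ zero    {y} m≤y y< = contradiction (subst (y <_) (ℕ.+-identityʳ m) y<) (ℕ.≤⇒≯ m≤y)
  ∈-pushes⁺ˡ (suc p) {y} m≤y y< with ℕ.m<1+n⇒m<n∨m≡n (subst (y <_) (ℕ.+-suc m p) y<)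
  ... | inj₁ y<m+p = there (∈-pushes⁺ˡ p m≤y y<m+p)
  ... | inj₂ refl  = here refl

  length-pushes : ∀ p → length (pushes m p st) ≡ p + length st
  length-pushes zero    = refl
  length-pushes (suc p) = cong suc (length-pushes p)

  pushes-descending : ∀ p → All (_< m) st → AllPairs _>_ st → AllPairs _>_ (pushes m p st)
  pushes-descending zero    st<m st↓ = st↓
  pushes-descending (suc p) st<m st↓ = All<-pushes p st<m ∷ pushes-descending p st<m st↓

-- Invariants of the two stacks

module Points (v : ℕ → ℕ) (e : ℕ → Maybe ℕ) where

  Descent : ℕ → Set
  Descent s = v (suc s) < v s

  descent? : ∀ s → Dec (Descent s)
  descent? s = v (suc s) <? v s

  indicator : {A : Set} → Dec A → ℕ
  indicator (yes _) = 1
  indicator (no _)  = 0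

  indicator-yes : {A : Set} (a? : Dec A) → A → indicator a? ≡ 1
  indicator-yes (yes _) a = refl
  indicator-yes (no ¬a) a = contradiction a ¬a

  indicator-no : {A : Set} (a? : Dec A) → ¬ A → indicator a? ≡ 0
  indicator-no (yes a) ¬a = contradiction a ¬a
  indicator-no (no _)  ¬a = refl

  #descents : ℕ → ℕ
  #descents zero    = 0
  #descents (suc s) = #descents s + indicator (descent? s)

  DescentInto : ℕ → Set
  DescentInto t = ∃[ s ] (t ≡ suc s × Descent s)

  descentInto? : ∀ t → Dec (DescentInto t)
  descentInto? zero    = no λ ()
  descentInto? (suc s) = map′ (λ d → s , refl , d) (λ { (_ , refl , d) → d }) (descent? s)

  -- The state of the machine before time t: m is one more than the maximal
  -- value read so far, and st contains the smaller values still to be read.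
  record Values (st : List ℕ) (m t : ℕ) : Set where
    field
      below      : ∀ {s} → s < t → v s < m
      injective  : ∀ {s s′} → s < t → s′ < t → v s ≡ v s′ → s ≡ s′
      top        : ∀ {x} → x < m → ∃[ a ] (a < t × x ≤ v a)
      avoids     : ∀ {a b c} → a < b → b < c → c < t → v b < v c → v c < v a → ⊥
      st-desc    : AllPairs _>_ st
      st-below   : All (_< m) st
      st-unread  : ∀ {x s} → x ∈ st → s < t → v s ≢ x
      -- This makes every pop a descent: the point read last was a new maximum or the former top of
      -- the stack.
      st-last    : ∀ {x s} → x ∈ st → t ≡ suc s → x < v s
      st-avoids  : ∀ {x a b} → x ∈ st → a < b → b < t → v b < x → x < v a → ⊥
      complete   : ∀ {x} → x < m → x ∈ st ⊎ (∃[ s ] (s < t × v s ≡ x))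
      size       : m ≡ length st + t

  -- hk contains the southwest endpoints before time t of the hooks that are
  -- still open.
  record Hooks (n : ℕ) (hk : List ℕ) (t : ℕ) : Set where
    field
      hk-desc     : AllPairs _>_ hk
      hk-descent  : ∀ {i} → i ∈ hk → suc i < t × Descent i
      hk-open     : ∀ {i j} → i ∈ hk → j < t → e j ≢ just i
      hk-complete : ∀ {i} → suc i < t → Descent i → i ∈ hk ⊎ (∃[ j ] (j < t × e j ≡ just i))
      -- An open hook that starts under a closed one could only end by crossing it.
      hk-nested   : ∀ {i i′ j} → i′ ∈ hk → j < t → e j ≡ just i → i < i′ → i′ < j → ⊥
      hook-sw     : ∀ {i j} → j < t → e j ≡ just i → suc i < j × Descent i
      hook-ne     : ∀ {i j} → j < t → e j ≡ just i → ∀ {l} → l < j → v l < v j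
      hook-unique : ∀ {i j j′} → j < t → j′ < t → e j ≡ just i → e j′ ≡ just i → j ≡ j′
      nested      : ∀ {i i′ j j′} → j < t → j′ < t → e j ≡ just i → e j′ ≡ just i′ →
                    i < i′ → i′ < j → j < j′ → ⊥
      -- `suc s < n` is essential: `v` is defined on all of ℕ, and `Descent` at the last position
      -- would compare with a value outside the permutation.
      reduced     : ∀ {s} → s < t →
                    (suc s < n × Descent s) ⊎ (∃[ i ] e s ≡ just i) ⊎ DescentInto s

  split : ∀ {s t} → s < suc t → s < t ⊎ s ≡ t
  split = ℕ.m<1+n⇒m<n∨m≡n

  values-start : Values [] 0 0
  values-start = record
    { below = λ () ; injective = λ () ; top = λ () ; avoids = λ _ _ ()
    ; st-desc = [] ; st-below = [] ; st-unread = λ () ; st-last = λ () ; st-avoids = λ ()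
    ; complete = λ () ; size = refl }

  hooks-start : ∀ {n} → Hooks n [] 0
  hooks-start = record
    { hk-desc = [] ; hk-descent = λ () ; hk-open = λ () ; hk-complete = λ () ; hk-nested = λ ()
    ; hook-sw = λ () ; hook-ne = λ () ; hook-unique = λ () ; nested = λ () ; reduced = λ () }

  values-drop : ∀ {x st m t} → Values (x ∷ st) m t → v t ≡ x → Values st m (suc t)
  values-drop {x} {st} {m} {t} V refl with V .Values.st-desc | V .Values.st-below
  ... | st<x ∷ st↓ | x<m ∷ st<m = record
    { below     = λ s<1+t → below′ (split s<1+t)
    ; injective = λ s<1+t s′<1+t → injective′ (split s<1+t) (split s′<1+t)
    ; top       = λ y<m → let a , a<t , y≤va = top y<m in a , ℕ.m<n⇒m<1+n a<t , y≤va
    ; avoids    = λ a<b b<c c<1+t → avoids′ a<b b<c (split c<1+t)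
    ; st-desc   = st↓
    ; st-below  = st<m
    ; st-unread = λ y∈ s<1+t → st-unread′ y∈ (split s<1+t)
    ; st-last   = λ { y∈ refl → All.lookup st<x y∈ }
    ; st-avoids = λ y∈ a<b b<1+t → st-avoids′ y∈ a<b (split b<1+t)
    ; complete  = complete′
    ; size      = trans size (sym (ℕ.+-suc (length st) t))
    }
    where
    open Values V
    below′ : ∀ {s} → s < t ⊎ s ≡ t → v s < m
    below′ (inj₁ s<t)  = below s<t
    below′ (inj₂ refl) = x<m
    injective′ : ∀ {s s′} → s < t ⊎ s ≡ t → s′ < t ⊎ s′ ≡ t → v s ≡ v s′ → s ≡ s′
    injective′ (inj₁ s<t)  (inj₁ s′<t) eq = injective s<t s′<t eq
    injective′ (inj₁ s<t)  (inj₂ refl) eq = contradiction eq (st-unread (here refl) s<t)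
    injective′ (inj₂ refl) (inj₁ s′<t) eq = contradiction (sym eq) (st-unread (here refl) s′<t)
    injective′ (inj₂ refl) (inj₂ refl) eq = refl
    avoids′ : ∀ {a b c} → a < b → b < c → c < t ⊎ c ≡ t → v b < v c → v c < v a → ⊥
    avoids′ a<b b<c (inj₁ c<t)  = avoids a<b b<c c<t
    avoids′ a<b b<t (inj₂ refl) = st-avoids (here refl) a<b b<t
    st-unread′ : ∀ {y s} → y ∈ st → s < t ⊎ s ≡ t → v s ≢ y
    st-unread′ y∈ (inj₁ s<t)  = st-unread (there y∈) s<t
    st-unread′ y∈ (inj₂ refl) = ℕ.>⇒≢ (All.lookup st<x y∈)
    st-avoids′ : ∀ {y a b} → y ∈ st → a < b → b < t ⊎ b ≡ t → v b < y → y < v a → ⊥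
    st-avoids′ y∈ a<b (inj₁ b<t)  vb<y = st-avoids (there y∈) a<b b<t vb<y
    st-avoids′ y∈ a<b (inj₂ refl) vt<y = contradiction vt<y (ℕ.<-asym (All.lookup st<x y∈))
    complete′ : ∀ {y} → y < m → y ∈ st ⊎ (∃[ s ] (s < suc t × v s ≡ y))
    complete′ y<m with complete y<m
    ... | inj₁ (here refl)     = inj₂ (t , ℕ.n<1+n t , refl)
    ... | inj₁ (there y∈)      = inj₁ y∈
    ... | inj₂ (s , s<t , vs) = inj₂ (s , ℕ.m<n⇒m<1+n s<t , vs)

  values-rise : ∀ {st m t} p → Values st m t → v t ≡ m + p →
                Values (pushes m p st) (suc (m + p)) (suc t)
  values-rise {st} {m} {t} p V vt = record
    { below     = λ s<1+t → below′ (split s<1+t)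
    ; injective = λ s<1+t s′<1+t → injective′ (split s<1+t) (split s′<1+t)
    ; top       = λ y<1+m+p → t , ℕ.n<1+n t , subst (_ ≤_) (sym vt) (ℕ.s≤s⁻¹ y<1+m+p)
    ; avoids    = λ a<b b<c c<1+t → avoids′ a<b b<c (split c<1+t)
    ; st-desc   = pushes-descending p st-below st-desc
    ; st-below  = All<-suc-pushes p st-below
    ; st-unread = λ y∈ s<1+t → st-unread′ y∈ (split s<1+t)
    ; st-last   = λ { y∈ refl → ∈<vt y∈ }
    ; st-avoids = λ y∈ a<b b<1+t → st-avoids′ y∈ a<b (split b<1+t)
    ; complete  = λ y<1+m+p → complete′ (split y<1+m+p)
    ; size      = size′
    }
    where
    open Values V
    m≤vt : m ≤ v t
    m≤vt = subst (m ≤_) (sym vt) (ℕ.m≤m+n m p)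
    new : ∀ {s} → s < t → v s < v t
    new s<t = ℕ.≤-trans (below s<t) m≤vt
    ∈<vt : ∀ {y} → y ∈ pushes m p st → y < v t
    ∈<vt y∈ = subst (_ <_) (sym vt) (All.lookup (All<-pushes p st-below) y∈)
    below′ : ∀ {s} → s < t ⊎ s ≡ t → v s < suc (m + p)
    below′ {s} (inj₁ s<t) = s≤s (ℕ.<⇒≤ (subst (v s <_) vt (new s<t)))
    below′ (inj₂ refl) = s≤s (ℕ.≤-reflexive vt)
    injective′ : ∀ {s s′} → s < t ⊎ s ≡ t → s′ < t ⊎ s′ ≡ t → v s ≡ v s′ → s ≡ s′
    injective′ (inj₁ s<t)  (inj₁ s′<t) eq = injective s<t s′<t eq
    injective′ (inj₁ s<t)  (inj₂ refl) eq = contradiction eq (ℕ.<⇒≢ (new s<t))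
    injective′ (inj₂ refl) (inj₁ s′<t) eq = contradiction eq (ℕ.>⇒≢ (new s′<t))
    injective′ (inj₂ refl) (inj₂ refl) eq = refl
    avoids′ : ∀ {a b c} → a < b → b < c → c < t ⊎ c ≡ t → v b < v c → v c < v a → ⊥
    avoids′ a<b b<c (inj₁ c<t)  = avoids a<b b<c c<t
    avoids′ a<b b<t (inj₂ refl) _ vt<va = ℕ.<-asym vt<va (new (ℕ.<-trans a<b b<t))
    st-unread′ : ∀ {y s} → y ∈ pushes m p st → s < t ⊎ s ≡ t → v s ≢ y
    st-unread′ y∈ (inj₂ refl) = ℕ.>⇒≢ (∈<vt y∈)
    st-unread′ y∈ (inj₁ s<t) with ∈-pushes⁻ p y∈
    ... | inj₁ (m≤y , _) = ℕ.<⇒≢ (ℕ.≤-trans (below s<t) m≤y)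
    ... | inj₂ y∈st      = st-unread y∈st s<t
    st-avoids′ : ∀ {y a b} → y ∈ pushes m p st → a < b → b < t ⊎ b ≡ t → v b < y → y < v a → ⊥
    st-avoids′ y∈ a<b (inj₂ refl) vt<y _ = ℕ.<-asym vt<y (∈<vt y∈)
    st-avoids′ y∈ a<b (inj₁ b<t) vb<y y<va with ∈-pushes⁻ p y∈
    ... | inj₁ (m≤y , _) = ℕ.<-asym (ℕ.≤-trans (below (ℕ.<-trans a<b b<t)) m≤y) y<va
    ... | inj₂ y∈st      = st-avoids y∈st a<b b<t vb<y y<va
    complete′ : ∀ {y} → y < m + p ⊎ y ≡ m + p →
                y ∈ pushes m p st ⊎ (∃[ s ] (s < suc t × v s ≡ y))
    complete′ (inj₂ refl) = inj₂ (t , ℕ.n<1+n t , vt)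
    complete′ {y} (inj₁ y<m+p) with y <? m
    ... | no y≮m  = inj₁ (∈-pushes⁺ˡ p (ℕ.≮⇒≥ y≮m) y<m+p)
    ... | yes y<m with complete y<m
    ...   | inj₁ y∈              = inj₁ (∈-pushes⁺ʳ p y∈)
    ...   | inj₂ (s , s<t , vs) = inj₂ (s , ℕ.m<n⇒m<1+n s<t , vs)
    size′ : suc (m + p) ≡ length (pushes m p st) + suc t
    size′ = trans (cong (λ m → suc (m + p)) size)
      (trans (lem (length st) t p) (cong (_+ suc t) (sym (length-pushes p))))
      where
      lem : ∀ l t p → suc (l + t + p) ≡ p + l + suc t
      lem = solve-∀

  hooks-drop : ∀ {n hk s} → Hooks n hk (suc s) → Descent s → e (suc s) ≡ nothing →
               Hooks n (s ∷ hk) (suc (suc s))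
  hooks-drop {n} {hk} {s} H d et = record
    { hk-desc     = All.tabulate (λ i∈ → ℕ.s≤s⁻¹ (proj₁ (hk-descent i∈))) ∷ hk-desc
    ; hk-descent  = λ { (here refl) → ℕ.n<1+n _ , d
                      ; (there i∈) → let lt , d′ = hk-descent i∈ in ℕ.m<n⇒m<1+n lt , d′ }
    ; hk-open     = hk-open′
    ; hk-complete = λ lt → hk-complete′ (split lt)
    ; hk-nested   = hk-nested′
    ; hook-sw     = λ j< ej → hook-sw (old j< ej) ej
    ; hook-ne     = λ j< ej → hook-ne (old j< ej) ej
    ; hook-unique = λ j< j′< ej ej′ → hook-unique (old j< ej) (old j′< ej′) ej ej′
    ; nested      = λ j< j′< ej ej′ → nested (old j< ej) (old j′< ej′) ej ej′
    ; reduced     = λ lt → reduced′ (split lt)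
    }
    where
    open Hooks H
    old : ∀ {i j} → j < suc (suc s) → e j ≡ just i → j < suc s
    old j< ej with split j<
    ... | inj₁ lt   = lt
    ... | inj₂ refl with () ← trans (sym et) ej
    hk-open′ : ∀ {i j} → i ∈ s ∷ hk → j < suc (suc s) → e j ≢ just i
    hk-open′ (here refl) j< ej =
      ℕ.<-asym (proj₁ (hook-sw (old j< ej) ej)) (old j< ej)
    hk-open′ (there i∈)  j< ej = hk-open i∈ (old j< ej) ej
    hk-complete′ : ∀ {i} → suc i < suc s ⊎ suc i ≡ suc s → Descent i →
                   i ∈ s ∷ hk ⊎ (∃[ j ] (j < suc (suc s) × e j ≡ just i))
    hk-complete′ (inj₂ refl) _ = inj₁ (here refl)
    hk-complete′ (inj₁ lt) d with hk-complete lt d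
    ... | inj₁ i∈             = inj₁ (there i∈)
    ... | inj₂ (j , j< , ej) = inj₂ (j , ℕ.m<n⇒m<1+n j< , ej)
    hk-nested′ : ∀ {i i′ j} → i′ ∈ s ∷ hk → j < suc (suc s) → e j ≡ just i → i < i′ → i′ < j → ⊥
    hk-nested′ (here refl) j< ej _ s<j = ℕ.<⇒≱ (old j< ej) s<j
    hk-nested′ (there i∈)  j< ej       = hk-nested i∈ (old j< ej) ej
    reduced′ : ∀ {r} → r < suc s ⊎ r ≡ suc s → _
    reduced′ (inj₁ lt)   = reduced lt
    reduced′ (inj₂ refl) = inj₂ (inj₂ (s , refl , d))

  -- The hypothesis `Descent t` looks one position ahead: point `t` has to be justified as reduced
  -- before its descent bottom is read.
  hooks-rise : ∀ {n hk t} → Hooks n hk t → (∀ {s} → s < t → v s < v t) → e t ≡ nothing →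
               suc t < n → Descent t → Hooks n hk (suc t)
  hooks-rise {n} {hk} {t} H new et t< d = record
    { hk-desc     = hk-desc
    ; hk-descent  = λ i∈ → let lt , d′ = hk-descent i∈ in ℕ.m<n⇒m<1+n lt , d′
    ; hk-open     = λ i∈ j< ej → hk-open i∈ (old j< ej) ej
    ; hk-complete = λ lt → hk-complete′ (split lt)
    ; hk-nested   = λ i∈ j< ej → hk-nested i∈ (old j< ej) ej
    ; hook-sw     = λ j< ej → hook-sw (old j< ej) ej
    ; hook-ne     = λ j< ej → hook-ne (old j< ej) ej
    ; hook-unique = λ j< j′< ej ej′ → hook-unique (old j< ej) (old j′< ej′) ej ej′
    ; nested      = λ j< j′< ej ej′ → nested (old j< ej) (old j′< ej′) ej ej′
    ; reduced     = λ lt → reduced′ (split lt)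
    }
    where
    open Hooks H
    old : ∀ {i j} → j < suc t → e j ≡ just i → j < t
    old j< ej with split j<
    ... | inj₁ lt   = lt
    ... | inj₂ refl with () ← trans (sym et) ej
    hk-complete′ : ∀ {i} → suc i < t ⊎ suc i ≡ t → Descent i →
                   i ∈ hk ⊎ (∃[ j ] (j < suc t × e j ≡ just i))
    hk-complete′ (inj₂ refl) d = contradiction d (ℕ.<-asym (new (ℕ.n<1+n _)))
    hk-complete′ (inj₁ lt)   d =
      Sum.map₂ (λ (j , j< , ej) → j , ℕ.m<n⇒m<1+n j< , ej) (hk-complete lt d)
    reduced′ : ∀ {r} → r < t ⊎ r ≡ t → _
    reduced′ (inj₁ lt)   = reduced lt
    reduced′ (inj₂ refl) = inj₁ (t< , d)

  hooks-close : ∀ {n i₀ hk t} → Hooks n (i₀ ∷ hk) t → (∀ {s} → s < t → v s < v t) →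
                e t ≡ just i₀ → Hooks n hk (suc t)
  hooks-close {n} {i₀} {hk} {t} H new et with H .Hooks.hk-desc
  ... | hk<i₀ ∷ hk↓ = record
    { hk-desc     = hk↓
    ; hk-descent  = λ i∈ → let lt , d = hk-descent (there i∈) in ℕ.m<n⇒m<1+n lt , d
    ; hk-open     = λ i∈ j< → hk-open′ i∈ (split j<)
    ; hk-complete = λ lt → hk-complete′ (split lt)
    ; hk-nested   = λ i∈ j< → hk-nested′ i∈ (split j<)
    ; hook-sw     = λ j< → hook-sw′ (split j<)
    ; hook-ne     = λ j< → hook-ne′ (split j<)
    ; hook-unique = λ j< j′< → hook-unique′ (split j<) (split j′<)
    ; nested      = λ j< j′< → nested′ (split j<) (split j′<)
    ; reduced     = λ lt → reduced′ (split lt)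
    }
    where
    open Hooks H
    hk-open′ : ∀ {i j} → i ∈ hk → j < t ⊎ j ≡ t → e j ≢ just i
    hk-open′ i∈ (inj₁ j<)   = hk-open (there i∈) j<
    hk-open′ i∈ (inj₂ refl) ej with refl ← trans (sym et) ej = ℕ.<-irrefl refl (All.lookup hk<i₀ i∈)
    hk-complete′ : ∀ {i} → suc i < t ⊎ suc i ≡ t → Descent i →
                   i ∈ hk ⊎ (∃[ j ] (j < suc t × e j ≡ just i))
    hk-complete′ (inj₂ refl) d = contradiction d (ℕ.<-asym (new (ℕ.n<1+n _)))
    hk-complete′ (inj₁ lt)   d with hk-complete lt d
    ... | inj₁ (here refl)    = inj₂ (t , ℕ.n<1+n t , et)
    ... | inj₁ (there i∈)     = inj₁ i∈
    ... | inj₂ (j , j< , ej) = inj₂ (j , ℕ.m<n⇒m<1+n j< , ej)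
    hk-nested′ : ∀ {i i′ j} → i′ ∈ hk → j < t ⊎ j ≡ t → e j ≡ just i → i < i′ → i′ < j → ⊥
    hk-nested′ i∈ (inj₁ j<)   ej = hk-nested (there i∈) j< ej
    hk-nested′ i∈ (inj₂ refl) ej i<i′ _ with refl ← trans (sym et) ej =
      ℕ.<-asym i<i′ (All.lookup hk<i₀ i∈)
    hook-sw′ : ∀ {i j} → j < t ⊎ j ≡ t → e j ≡ just i → suc i < j × Descent i
    hook-sw′ (inj₁ j<)   ej = hook-sw j< ej
    hook-sw′ (inj₂ refl) ej with refl ← trans (sym et) ej = hk-descent (here refl)
    hook-ne′ : ∀ {i j} → j < t ⊎ j ≡ t → e j ≡ just i → ∀ {l} → l < j → v l < v j
    hook-ne′ (inj₁ j<)   ej = hook-ne j< ej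
    hook-ne′ (inj₂ refl) ej = new
    fresh : ∀ {i j} → j < t → e j ≡ just i → e t ≢ just i
    fresh j< ej et′ with refl ← trans (sym et) et′ = hk-open (here refl) j< ej
    hook-unique′ : ∀ {i j j′} → j < t ⊎ j ≡ t → j′ < t ⊎ j′ ≡ t →
                   e j ≡ just i → e j′ ≡ just i → j ≡ j′
    hook-unique′ (inj₁ j<)   (inj₁ j′<)  ej ej′ = hook-unique j< j′< ej ej′
    hook-unique′ (inj₁ j<)   (inj₂ refl) ej ej′ = contradiction ej′ (fresh j< ej)
    hook-unique′ (inj₂ refl) (inj₁ j′<)  ej ej′ = contradiction ej (fresh j′< ej′)
    hook-unique′ (inj₂ refl) (inj₂ refl) ej ej′ = refl
    nested′ : ∀ {i i′ j j′} → j < t ⊎ j ≡ t → j′ < t ⊎ j′ ≡ t → e j ≡ just i → e j′ ≡ just i′ →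
              i < i′ → i′ < j → j < j′ → ⊥
    nested′ (inj₁ j<)   (inj₁ j′<)  ej ej′ i<i′ i′<j j<j′ = nested j< j′< ej ej′ i<i′ i′<j j<j′
    nested′ (inj₁ j<)   (inj₂ refl) ej ej′ i<i′ i′<j j<j′ with refl ← trans (sym et) ej′ =
      hk-nested (here refl) j< ej i<i′ i′<j
    nested′ (inj₂ refl) (inj₁ j′<)  ej ej′ i<i′ i′<j j<j′ = ℕ.<-asym j<j′ j′<
    nested′ (inj₂ refl) (inj₂ refl) ej ej′ i<i′ i′<j j<j′ = ℕ.<-irrefl refl j<j′
    reduced′ : ∀ {r} → r < t ⊎ r ≡ t → _
    reduced′ (inj₁ lt)   = reduced lt
    reduced′ (inj₂ refl) = inj₂ (inj₁ (i₀ , et))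

  -- A reduced valid hook configuration with k hooks on the 312-avoiding
  -- permutation t ↦ v t, where e t is the southwest endpoint of the hook
  -- whose northeast endpoint is t.
  record RedVHCℕ (n k : ℕ) : Set where
    field
      bounded      : ∀ {t} → t < n → v t < n
      injective    : ∀ {s t} → s < n → t < n → v s ≡ v t → s ≡ t
      surjective   : ∀ {x} → x < n → ∃[ t ] (t < n × v t ≡ x)
      avoids       : ∀ {a b c} → a < b → b < c → c < n → v b < v c → v c < v a → ⊥
      hook-<       : ∀ {i j} → j < n → e j ≡ just i → i < j × v i < v j
      hook⇒descent : ∀ {i j} → j < n → e j ≡ just i → suc i < n × Descent i
      descent⇒hook : ∀ {i} → suc i < n → Descent i → ∃[ j ] (j < n × e j ≡ just i)
      nothingAbove : ∀ {i j l} → j < n → e j ≡ just i → i < l → l < j → ¬ v j < v l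
      -- Disjointness in terms of endpoints: `unique` forbids a shared southwest endpoint and
      -- `nested` a crossing, while a shared northeast endpoint cannot be expressed because `e` is a
      -- function.
      unique       : ∀ {i j j′} → j < n → j′ < n → e j ≡ just i → e j′ ≡ just i → j ≡ j′
      nested       : ∀ {i i′ j j′} → j < n → j′ < n → e j ≡ just i → e j′ ≡ just i′ →
                     i < i′ → i′ < j → j < j′ → ⊥
      reduced      : ∀ {s} → s < n →
                     (suc s < n × Descent s) ⊎ (∃[ i ] e s ≡ just i) ⊎ DescentInto s
      size         : #descents (pred n) ≡ k

module Spec (K n : ℕ) (v : ℕ → ℕ) (e : ℕ → Maybe ℕ) where

  open Points v e
  open Machine K n v e

  new-maximum : ∀ {st m t} p → Values st m t → v t ≡ m + p → ∀ {s} → s < t → v s < v t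
  new-maximum {m = m} p V vt {s} s<t =
    ℕ.≤-trans (Values.below V s<t) (subst (m ≤_) (sym vt) (ℕ.m≤m+n m p))

  #descents-new-maximum : ∀ {t} → (∀ {s} → s < t → v s < v t) → #descents t ≡ #descents (pred t)
  #descents-new-maximum {zero}  new = refl
  #descents-new-maximum {suc s} new = trans
    (cong (λ z → #descents s + z) (indicator-no (descent? s) (ℕ.<-asym (new (ℕ.n<1+n s)))))
    (ℕ.+-identityʳ _)

  #descents-descent : ∀ {s} → Descent s → ∀ b → #descents (suc s) + b ≡ #descents s + suc b
  #descents-descent {s} d b = trans
    (cong (λ i → #descents s + i + b) (indicator-yes (descent? s) d))
    (ℕ.+-assoc (#descents s) 1 b)

  -- Descents read plus descents ahead stay constant. The count stops at `pred t` because a descent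
  -- is visible only once its bottom has been read.
  invariants : ∀ {b hk st m t k} → Values st m t → Hooks n hk t → #descents (pred t) + b ≡ k →
               Run b hk st m t → ∃[ m′ ] (Values [] m′ n × Hooks n [] n × #descents (pred n) ≡ k)
  invariants-drop : ∀ {b hk st m t k} → Values st m t → Hooks n hk t → #descents (pred t) + b ≡ k →
               Bottom b hk st m t → ∃[ m′ ] (Values [] m′ n × Hooks n [] n × #descents (pred n) ≡ k)
  invariants V H c (end refl) = _ , V , H , trans (sym (ℕ.+-identityʳ _)) c
  invariants V H c (drop B)   = invariants-drop V H c B
  invariants {b} V H c (close p _ vt et R) = invariants (values-rise p V vt) (hooks-close H new et)
    (trans (cong (_+ b) (#descents-new-maximum new)) c) R
    where
    new : ∀ {s} → s < _ → v s < v _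
    new = new-maximum p V vt
  invariants {b} V H c (rise {t = t} p _ vt et B) = invariants-drop V′
    (hooks-rise H new et (1+t<n B) (descent-t B V′))
    (trans (cong (_+ b) (#descents-new-maximum new)) c) B
    where
    V′ = values-rise p V vt
    new : ∀ {s} → s < t → v s < v t
    new = new-maximum p V vt
    1+t<n : ∀ {b hk st m} → Bottom b hk st m (suc t) → suc t < n
    1+t<n {hk = hk} (pop {b = b} _ _ R) = ℕ.≤-trans (ℕ.m≤n+m (2 + t) (suc (length hk)))
      (ℕ.≤-trans (ℕ.m≤n+m (suc (length hk) + (2 + t)) (2 ℕ.* b)) (Run-lower R))
    descent-t : ∀ {b hk st m} → Bottom b hk st m (suc t) → Values st m (suc t) → Descent t
    descent-t (pop refl _ _) V = Values.st-last V (here refl) refl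
  invariants-drop {t = zero} V H c (pop vt et R)
    with _ , () , _ ← Values.top V (All.lookup (Values.st-below V) (here refl))
  invariants-drop {t = suc s} V H c (pop {b = b} refl et R) =
    invariants (values-drop V refl) (hooks-drop H d et) (trans (#descents-descent d b) c) R
    where
    d : Descent s
    d = Values.st-last V (here refl) refl

  Run⇒RedVHCℕ : ∀ {k} → Run k [] [] 0 0 → RedVHCℕ n k
  Run⇒RedVHCℕ R with m , V , H , c ← invariants values-start hooks-start refl R
               -- An empty stack at time `n` forces `m ≡ n`, so `below` becomes boundedness and
               -- `complete` surjectivity.
               with refl ← Values.size V = record
    { bounded      = below
    ; injective    = injective
    ; surjective   = λ x<n → Sum.[ (λ ()) , (λ s → s) ] (complete x<n)
    ; avoids       = avoids
    ; hook-<       = λ j<n ej → let lt , _ = hook-sw j<n ej in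
                       ℕ.<-trans (ℕ.n<1+n _) lt , hook-ne j<n ej (ℕ.<-trans (ℕ.n<1+n _) lt)
    ; hook⇒descent = λ j<n ej → let lt , d = hook-sw j<n ej in ℕ.<-trans lt j<n , d
    ; descent⇒hook = λ lt d → Sum.[ (λ ()) , (λ h → h) ] (hk-complete lt d)
    ; nothingAbove = λ j<n ej _ l<j → ℕ.<-asym (hook-ne j<n ej l<j)
    ; unique       = hook-unique
    ; nested       = nested
    ; reduced      = reduced
    ; size         = c
    }
    where
    open Values V
    open Hooks H

  -- The run of a given configuration

  module _ {k} (spec : RedVHCℕ n k) (n≤K : n ≤ K) where

    open RedVHCℕ spec

    stack-empty : ∀ {st m} → Values st m n → st ≡ []
    stack-empty {[]}     V = refl
    stack-empty {x ∷ st} V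
      with a , a<n , x≤va ← Values.top V (All.lookup (Values.st-below V) (here refl))
      with c , c<n , vc ← surjective (ℕ.≤-<-trans x≤va (bounded a<n)) =
      contradiction vc (Values.st-unread V (here refl) c<n)

    hooks-closed : ∀ {hk} → Hooks n hk n → hk ≡ []
    hooks-closed {[]}     H = refl
    hooks-closed {i ∷ hk} H
      with lt , d ← Hooks.hk-descent H (here refl)
      with j , j<n , ej ← descent⇒hook lt d = contradiction ej (Hooks.hk-open H (here refl) j<n)

    -- A hook ending at a descent bottom would have the descent top above it, or start at that top
    -- and go down.
    bottom-unhooked : ∀ {s} → suc s < n → Descent s → e (suc s) ≡ nothing
    bottom-unhooked {s} 1+s<n d with e (suc s) in es
    ... | nothing = refl
    ... | just i with i<1+s , vi<v1+s ← hook-< 1+s<n es with ℕ.m<1+n⇒m<n∨m≡n i<1+s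
    ...   | inj₁ i<s  = contradiction d (nothingAbove 1+s<n es i<s (ℕ.n<1+n s))
    ...   | inj₂ refl = contradiction d (ℕ.<-asym vi<v1+s)

    -- If an earlier value exceeded `v t`, then either the preceding value is larger, making `t` a
    -- descent bottom, or it is smaller and is the 1 of a 312 ending at `t`.
    not-bottom : ∀ {st m t} → t < n → Values st m t → ¬ DescentInto t → m ≤ v t
    not-bottom {m = m} {t} t<n V ¬d with m ℕ.≤? v t
    ... | yes m≤vt = m≤vt
    ... | no m≰vt with a , a<t , vt≤va ← Values.top V (ℕ.≰⇒> m≰vt) = ⊥-elim (go t refl)
      where
      vt<va : v t < v a
      vt<va = ℕ.≤∧≢⇒< vt≤va (λ eq → ℕ.>⇒≢ a<t (injective t<n (ℕ.<-trans a<t t<n) eq))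
      go : ∀ t′ → t ≡ t′ → ⊥
      go zero    refl = contradiction a<t (λ ())
      go (suc s) refl with ℕ.m<1+n⇒m<n∨m≡n a<t
      ... | inj₂ refl = ¬d (s , refl , vt<va)
      ... | inj₁ a<s with ℕ.<-cmp (v s) (v t)
      ...   | tri< vs<vt _ _ = avoids a<s (ℕ.n<1+n s) t<n vs<vt vt<va
      ...   | tri≈ _ eq _    =
        ℕ.<⇒≢ (ℕ.n<1+n s) (injective (ℕ.<-trans (ℕ.n<1+n s) t<n) t<n eq)
      ...   | tri> _ _ vt<vs = ¬d (s , refl , vt<vs)

    -- If a smaller value than the top `x` were read, `x` would come later and complete a 312 with
    -- an earlier larger value. A larger value would be missing from the decreasing stack.
    head-of-stack : ∀ {st m s} → suc s < n → Values st m (suc s) → Descent s →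
                    ∃[ st′ ] (st ≡ v (suc s) ∷ st′)
    head-of-stack {[]} {m} {s} lt V d
      with Values.complete V (ℕ.<-trans d (Values.below V (ℕ.n<1+n s)))
    ... | inj₂ (r , r<t , vr) = contradiction (injective (ℕ.<-trans r<t lt) lt vr) (ℕ.<⇒≢ r<t)
    head-of-stack {x ∷ st} {m} {s} lt V d with ℕ.<-cmp (v (suc s)) x
    ... | tri≈ _ refl _ = st , refl
    ... | tri> ≮ ≢ x<v
        with Values.complete V (ℕ.<-trans d (Values.below V (ℕ.n<1+n s)))
    ...   | inj₂ (r , r<t , vr)  = contradiction (injective (ℕ.<-trans r<t lt) lt vr) (ℕ.<⇒≢ r<t)
    ...   | inj₁ (here eq)       = contradiction eq ≢
    ...   | inj₁ (there v∈) with x>st ∷ _ ← Values.st-desc V =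
              contradiction (All.lookup x>st v∈) (ℕ.<-asym x<v)
    head-of-stack {x ∷ st} {m} {s} lt V d | tri< v<x _ _
      with a , a<t , x≤va ← Values.top V (All.lookup (Values.st-below V) (here refl))
      with c , c<n , refl ← surjective (ℕ.≤-<-trans x≤va (bounded (ℕ.<-trans a<t lt)))
      with ℕ.<-cmp c (suc s)
    ...   | tri< c<t _ _  = contradiction refl (Values.st-unread V (here refl) c<t)
    ...   | tri≈ _ refl _ = contradiction v<x (ℕ.<-irrefl refl)
    ...   | tri> _ _ t<c  = ⊥-elim (avoids a<t t<c c<n v<x (ℕ.≤∧≢⇒< x≤va
              (λ eq → Values.st-unread V (here refl) a<t (sym eq))))

    -- Otherwise the most recent open hook starts under the hook ending at `t` and ends later,
    -- against `nested`. Since `t` is no descent bottom, the hook from `i` starts before `t - 1` and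
    -- so is already on the stack.
    head-of-hooks : ∀ {hk t i} → t < n → Hooks n hk t → ¬ DescentInto t → e t ≡ just i →
                    ∃[ hk′ ] (hk ≡ i ∷ hk′)
    head-of-hooks {hk} {t} {i} t<n H ¬d et = go hk H i∈
      where
      i<t = proj₁ (hook-< t<n et)
      di = proj₂ (hook⇒descent t<n et)
      1+i<t : suc i < t
      1+i<t = ℕ.≤∧≢⇒< i<t (λ eq → ¬d (i , sym eq , di))
      i∈ : i ∈ hk
      i∈ with Hooks.hk-complete H 1+i<t di
      ... | inj₁ i∈             = i∈
      ... | inj₂ (j , j<t , ej) =
        contradiction (unique (ℕ.<-trans j<t t<n) t<n ej et) (ℕ.<⇒≢ j<t)
      go : ∀ hk → Hooks n hk t → i ∈ hk → ∃[ hk′ ] (hk ≡ i ∷ hk′)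
      go (i₀ ∷ hk) H (here refl) = hk , refl
      go (i₀ ∷ hk) H (there i∈)
        with hk<i₀ ∷ _ ← Hooks.hk-desc H
        with lt , d ← Hooks.hk-descent H (here refl)
        with j , j<n , ej ← descent⇒hook (ℕ.<-trans lt t<n) d
        with ℕ.<-cmp j t
      ... | tri< j<t _ _ = contradiction ej (Hooks.hk-open H (here refl) j<t)
      ... | tri≈ _ refl _ with refl ← trans (sym et) ej =
        contradiction (All.lookup hk<i₀ i∈) (ℕ.<-irrefl refl)
      ... | tri> _ _ t<j =
        ⊥-elim (nested t<n j<n et ej (All.lookup hk<i₀ i∈) (ℕ.<-trans (ℕ.n<1+n _) lt) t<j)

    -- The number of descents ahead is an output, known only when the rest of the run is built; the
    -- equation on `#descents` identifies it with `k` at the start.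
    run : ∀ r {hk st m t} → t + r ≡ n → Values st m t → Hooks n hk t →
          ∃[ b ] (Run b hk st m t × #descents (pred t) + b ≡ #descents (pred n))
    run-bottom : ∀ r {hk st m s} → suc s + r ≡ n → suc s < n → Values st m (suc s) →
                 Hooks n hk (suc s) → Descent s →
                 ∃[ b ] (Bottom b hk st m (suc s) × #descents s + b ≡ #descents (pred n))

    run-bottom zero    {s = s} s+r lt V H d =
      contradiction (trans (sym (ℕ.+-identityʳ (suc s))) s+r) (ℕ.<⇒≢ lt)
    run-bottom (suc r) {hk} {st} {m} {s} s+r lt V H d
      with st′ , refl ← head-of-stack lt V d
      with b , R , eq ← run r (trans (sym (ℕ.+-suc (suc s) r)) s+r)
                              (values-drop V refl) (hooks-drop H d (bottom-unhooked lt d)) =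
      suc b , pop refl (bottom-unhooked lt d) R , trans (sym (#descents-descent d b)) eq

    run zero {t = t} t+r V H with refl ← trans (sym (ℕ.+-identityʳ t)) t+r
      with refl ← stack-empty V | refl ← hooks-closed H = 0 , end refl , ℕ.+-identityʳ _
    run (suc r) {hk} {st} {m} {t} t+r V H with descentInto? t
    ... | yes (s , refl , d)
          with b , B , eq ← run-bottom (suc r) t+r (subst (t <_) t+r (ℕ.m<m+n t (s≤s z≤n))) V H d =
          b , drop B , eq
    ... | no ¬d = go (e t) refl
      where
      t<n : t < n
      t<n = subst (t <_) t+r (ℕ.m<m+n t (s≤s z≤n))
      1+t+r : suc t + r ≡ n
      1+t+r = trans (sym (ℕ.+-suc t r)) t+r
      p = v t ∸ m
      vt : v t ≡ m + p
      vt = sym (ℕ.m+[n∸m]≡n (not-bottom t<n V ¬d))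
      -- The skipped values are among fewer than `n` values, which is why a cutoff `K` of at least
      -- `n` loses nothing.
      p<K : p < K
      p<K = ℕ.≤-<-trans (ℕ.m∸n≤m (v t) m) (ℕ.≤-trans (bounded t<n) n≤K)
      V′ = values-rise p V vt
      new : ∀ {s} → s < t → v s < v t
      new = new-maximum p V vt
      go : ∀ y → e t ≡ y → ∃[ b ] (Run b hk st m t × #descents (pred t) + b ≡ #descents (pred n))
      go (just i) et with _ , refl ← head-of-hooks t<n H ¬d et
        with b , R , eq ← run r 1+t+r V′ (hooks-close H new et) =
        b , close p p<K vt et R , trans (cong (_+ b) (sym (#descents-new-maximum new))) eq
      go nothing et with reduced t<n
      ... | inj₂ (inj₁ (i , et′)) with () ← trans (sym et) et′
      ... | inj₂ (inj₂ d) = contradiction d ¬d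
      ... | inj₁ (lt , d)
        with b , B , eq ← run-bottom r 1+t+r lt V′ (hooks-rise H new et lt d) d =
        b , rise p p<K vt et B , trans (cong (_+ b) (sym (#descents-new-maximum new))) eq

    RedVHCℕ⇒Run : Run k [] [] 0 0
    RedVHCℕ⇒Run with b , R , eq ← run n refl values-start hooks-start
                 with refl ← trans eq size = R

-- Configurations as functions on ℕ

-- Nothing is required of `v` and `e` from `n` on. The equation in `hook⁺` already forces hooks with
-- the same northeast endpoint to coincide.
record Represents {n} (c : Configuration n) (v : ℕ → ℕ) (e : ℕ → Maybe ℕ) : Set where
  field
    value : ∀ t → v (toℕ t) ≡ toℕ (lookup (proj₁ c) t)
    hook⁺ : ∀ {i j} → (i , j) ∈ₕ proj₂ c → e (toℕ j) ≡ just (toℕ i)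
    hook⁻ : ∀ {j x} → e (toℕ j) ≡ just x → ∃[ i ] (toℕ i ≡ x × (i , j) ∈ₕ proj₂ c)

lookup-injective : {A : Set} (xs ys : Vec A n) → (∀ i → lookup xs i ≡ lookup ys i) → xs ≡ ys
lookup-injective xs ys eq =
  trans (sym (Vec.tabulate∘lookup xs)) (trans (Vec.tabulate-cong eq) (Vec.tabulate∘lookup ys))

represents-injective : ∀ {c c′ : Configuration n} {v e} →
                       Represents c v e → Represents c′ v e → c ≡ c′
represents-injective {c = π , H} {π′ , H′} r r′ = cong₂ _,_
  (lookup-injective π π′ λ t →
    Fin.toℕ-injective (trans (sym (Represents.value r t)) (Represents.value r′ t)))
  (lookup-injective H H′ λ i → Subset.⊆-antisym (transfer r r′) (transfer r′ r))
  where
  transfer : ∀ {c c′ : Configuration n} {v e} → Represents c v e → Represents c′ v e →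
             ∀ {i j} → (i , j) ∈ₕ proj₂ c → (i , j) ∈ₕ proj₂ c′
  transfer r r′ h with i′ , eq , h′ ← Represents.hook⁻ r′ (Represents.hook⁺ r h)
                  with refl ← Fin.toℕ-injective eq = h′

represents-functional : ∀ {c : Configuration n} {v v′ e e′} →
                        Represents c v e → Represents c v′ e′ →
                        ∀ t → v (toℕ t) ≡ v′ (toℕ t) × e (toℕ t) ≡ e′ (toℕ t)
represents-functional {e = e} {e′} r r′ t =
  trans (Represents.value r t) (sym (Represents.value r′ t)) ,
  partner (e (toℕ t)) (e′ (toℕ t)) refl refl
  where
  partner : ∀ y y′ → e (toℕ t) ≡ y → e′ (toℕ t) ≡ y′ → e (toℕ t) ≡ e′ (toℕ t)
  partner nothing  nothing  et et′ = trans et (sym et′)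
  partner (just _) y′       et et′ with i , refl , h ← Represents.hook⁻ r et =
    trans et (sym (Represents.hook⁺ r′ h))
  partner nothing  (just _) et et′ with i , refl , h ← Represents.hook⁻ r′ et′ =
    trans (Represents.hook⁺ r h) (sym et′)

trace-ext : ∀ w w′ → length w ≡ length w′ →
            (∀ {t} → t < length w → valueAt w t ≡ valueAt w′ t × partnerAt w t ≡ partnerAt w′ t) →
            w ≡ w′
trace-ext []            []               len eq = refl
trace-ext ((x , y) ∷ w) ((x′ , y′) ∷ w′) len eq = cong₂ _∷_
  (cong₂ _,_ (proj₁ (eq (s≤s z≤n))) (proj₂ (eq (s≤s z≤n))))
  (trace-ext w w′ (ℕ.suc-injective len) (λ t< → eq (s≤s t<)))

fin : ∀ {t} → t < n → ∃[ τ ] (toℕ {n} τ ≡ t)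
fin t<n = fromℕ< t<n , Fin.toℕ-fromℕ< t<n

sumBelow : (ℕ → ℕ) → ℕ → ℕ
sumBelow g zero    = 0
sumBelow g (suc m) = sumBelow g m + g m

sumBelow-suc : ∀ g m → sumBelow g (suc m) ≡ g 0 + sumBelow (g ∘ suc) m
sumBelow-suc g zero    = ℕ.+-comm 0 (g 0)
sumBelow-suc g (suc m) = trans (cong (_+ g (suc m)) (sumBelow-suc g m))
                               (ℕ.+-assoc (g 0) (sumBelow (g ∘ suc) m) (g (suc m)))

sum-rows : ∀ {m} (rows : Vec (Subset n) m) g → (∀ i → ∣ lookup rows i ∣ ≡ g (toℕ i)) →
           Vec.sum (Vec.map ∣_∣ rows) ≡ sumBelow g m
sum-rows []           g eq = refl
sum-rows (row ∷ rows) g eq = trans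
  (cong₂ _+_ (eq Fin.zero) (sum-rows rows (g ∘ suc) (eq ∘ Fin.suc)))
  (sym (sumBelow-suc g _))

∣_∣≡1 : ∀ {p : Subset n} {x} → x Subset.∈ p → (∀ {y} → y Subset.∈ p → y ≡ x) → ∣ p ∣ ≡ 1
∣_∣≡1 {x = x} x∈ only = trans
  (cong ∣_∣ (Subset.⊆-antisym (λ y∈ → subst (Subset._∈ ⁅ x ⁆) (sym (only y∈)) (Subset.x∈⁅x⁆ x))
                              (λ y∈ → subst (Subset._∈ _) (sym (Subset.x∈⁅y⁆⇒x≡y x y∈)) x∈)))
  (Subset.∣⁅x⁆∣≡1 x)

module _ {v : ℕ → ℕ} {e : ℕ → Maybe ℕ} {π : Word n} {H : HookSet n}
         (r : Represents (π , H) v e) where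

  open Represents r
  open Points v e

  descentTop⇔ : ∀ i → IsDescentTop π i ⇔ (suc (toℕ i) < n × Descent (toℕ i))
  descentTop⇔ i = mk⇔ to from
    where
    to : IsDescentTop π i → suc (toℕ i) < n × Descent (toℕ i)
    to (i′ , eq , πi>πi′) = subst (_< n) eq (Fin.toℕ<n i′) ,
      subst₂ _<_ (trans (sym (value i′)) (cong v eq)) (sym (value i)) πi>πi′
    from : suc (toℕ i) < n × Descent (toℕ i) → IsDescentTop π i
    from (lt , d) with i′ , eq ← fin lt = i′ , eq ,
      subst₂ _<_ (trans (cong v (sym eq)) (value i′)) (value i) d

  descentBottom⇔ : ∀ i → IsDescentBottom π i ⇔ DescentInto (toℕ i)
  descentBottom⇔ i = mk⇔ to from
    where
    to : IsDescentBottom π i → DescentInto (toℕ i)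
    to (i′ , eq , lt) = toℕ i′ , eq ,
      subst₂ _<_ (trans (sym (value i)) (cong v eq)) (sym (value i′)) lt
    from : DescentInto (toℕ i) → IsDescentBottom π i
    from (s , eq , d) with i′ , refl ← fin {n} (ℕ.<-trans (subst (s <_) (sym eq) (ℕ.n<1+n s)) (Fin.toℕ<n i)) =
      i′ , eq , subst₂ _<_ (trans (cong v (sym eq)) (value i)) (value i′) d

  module _ (southwest : ∀ i → (∃[ j ] (i , j) ∈ₕ H) ⇔ (suc (toℕ i) < n × Descent (toℕ i)))
           (unique : ∀ {i j j′} → (i , j) ∈ₕ H → (i , j′) ∈ₕ H → j ≡ j′) where

    -- A row has at most one entry, and the last one is empty whatever value `v` takes past the end.
    rowSize : ℕ → ℕ
    rowSize s with suc s <? n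
    ... | yes _ = indicator (descent? s)
    ... | no _  = 0

    ∣row∣ : ∀ i → ∣ lookup H i ∣ ≡ rowSize (toℕ i)
    ∣row∣ i with suc (toℕ i) <? n
    ... | no ≮   = empty (λ h → ≮ (proj₁ (Equivalence.to (southwest i) h)))
      where
      empty : ¬ (∃[ j ] (i , j) ∈ₕ H) → ∣ lookup H i ∣ ≡ 0
      empty ∄ = trans (cong ∣_∣ (Subset.Empty-unique ∄)) (Subset.∣⊥∣≡0 n)
    ... | yes lt = by-descent (descent? (toℕ i))
      where
      by-descent : (d? : Dec (Descent (toℕ i))) → ∣ lookup H i ∣ ≡ indicator d?
      by-descent (yes d) with j , h ← Equivalence.from (southwest i) (lt , d) =
        ∣_∣≡1 h (λ h′ → unique h′ h)
      by-descent (no ¬d) = trans (cong ∣_∣ (Subset.Empty-unique λ h →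
        ¬d (proj₂ (Equivalence.to (southwest i) h)))) (Subset.∣⊥∣≡0 n)

    rowSize-< : ∀ {m} → m < n → sumBelow rowSize m ≡ #descents m
    rowSize-< {zero}  lt = refl
    rowSize-< {suc m} lt with suc m <? n
    ... | yes _ = cong (_+ _) (rowSize-< (ℕ.<-trans (ℕ.n<1+n m) lt))
    ... | no ≮  = contradiction lt ≮

    rowSize-last : ∀ {m} → m ≡ n → sumBelow rowSize m ≡ #descents (pred m)
    rowSize-last {zero}  eq = refl
    rowSize-last {suc m} eq with suc m <? n
    ... | yes lt = contradiction eq (ℕ.<⇒≢ lt)
    ... | no _   = trans (ℕ.+-identityʳ _) (rowSize-< (subst (m <_) eq (ℕ.n<1+n m)))

    ∣H∣ₕ≡#descents : ∣ H ∣ₕ ≡ #descents (pred n)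
    ∣H∣ₕ≡#descents = trans (sum-rows H rowSize ∣row∣) (rowSize-last refl)

-- Pairs of hooks excluded by disjointness

module _ {π : Word n} {H : HookSet n} (V : IsVHC π H) where

  open IsVHC V

  -- The corner of the shorter hook lies inside the horizontal segment of the longer one.
  no-shared-ne : ∀ {i i′ j} → (i , j) ∈ₕ H → (i′ , j) ∈ₕ H → ¬ i Fin.< i′
  no-shared-ne {i} {i′} {j} h h′ i<i′
    with nonIntersect (i , j) (i′ , j) h h′ (λ { refl → ℕ.<-irrefl refl i<i′ }) (i′ , lookup π j)
           (inj₂ (refl , ℕ.<⇒≤ i<i′ , ℕ.<⇒≤ (proj₁ (hooks _ h′))))
           (inj₁ (refl , ℕ.<⇒≤ (proj₂ (hooks _ h′)) , ℕ.≤-refl))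
  ... | inj₁ eq , _ = ℕ.<⇒≢ i<i′ (cong (toℕ ∘ proj₁) (sym eq))
  ... | inj₂ eq , _ = ℕ.<⇒≢ (proj₁ (hooks _ h′)) (cong (toℕ ∘ proj₁) eq)

  ne-unique : ∀ {i i′ j} → (i , j) ∈ₕ H → (i′ , j) ∈ₕ H → i ≡ i′
  ne-unique {i} {i′} h h′ with Fin.<-cmp i i′
  ... | tri< i<i′ _ _ = contradiction i<i′ (no-shared-ne h h′)
  ... | tri≈ _ eq _   = eq
  ... | tri> _ _ i′<i = contradiction i′<i (no-shared-ne h′ h)

  -- The corner of the lower hook lies on both vertical segments and is no endpoint of the lower
  -- hook.
  no-shared-sw : ∀ {i j j′} → (i , j) ∈ₕ H → (i , j′) ∈ₕ H → ¬ lookup π j Fin.< lookup π j′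
  no-shared-sw {i} {j} {j′} h h′ lt
    with nonIntersect (i , j) (i , j′) h h′ (λ { refl → ℕ.<-irrefl refl lt }) (i , lookup π j)
           (inj₁ (refl , ℕ.<⇒≤ (proj₂ (hooks _ h)) , ℕ.≤-refl))
           (inj₁ (refl , ℕ.<⇒≤ (proj₂ (hooks _ h)) , ℕ.<⇒≤ lt))
  ... | inj₁ eq , _ = ℕ.>⇒≢ (proj₂ (hooks _ h)) (cong (toℕ ∘ proj₂) eq)
  ... | inj₂ eq , _ = ℕ.<⇒≢ (proj₁ (hooks _ h)) (cong (toℕ ∘ proj₁) eq)

  -- The horizontal segment of the first hook meets the vertical segment of the second at height
  -- `lookup π j`. That this height is within range follows from `nothingAbove`, applied once to
  -- each hook.
  no-crossing : ∀ {i i′ j j′} → (i , j) ∈ₕ H → (i′ , j′) ∈ₕ H → i Fin.< i′ → i′ Fin.< j → ¬ j Fin.< j′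
  no-crossing {i} {i′} {j} {j′} h h′ i<i′ i′<j j<j′
    with nonIntersect (i , j) (i′ , j′) h h′ (λ { refl → ℕ.<-irrefl refl i<i′ }) (i′ , lookup π j)
           (inj₂ (refl , ℕ.<⇒≤ i<i′ , ℕ.<⇒≤ i′<j))
           (inj₁ (refl , ℕ.≮⇒≥ (λ lt → nothingAbove i j h (i′ , i<i′ , i′<j , lt))
                       , ℕ.≮⇒≥ (λ lt → nothingAbove i′ j′ h′ (j , i′<j , j<j′ , lt))))
  ... | inj₁ eq , _ = ℕ.>⇒≢ i<i′ (cong (toℕ ∘ proj₁) eq)
  ... | inj₂ eq , _ = ℕ.<⇒≢ i′<j (cong (toℕ ∘ proj₁) eq)

module _ {v : ℕ → ℕ} {e : ℕ → Maybe ℕ} {π : Word n} {H : HookSet n}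
         (r : Represents (π , H) v e) where

  open Represents r
  open Points v e

  value-< : ∀ {a b} → lookup π a Fin.< lookup π b → v (toℕ a) < v (toℕ b)
  value-< {a} {b} = subst₂ _<_ (sym (value a)) (sym (value b))

  value-<⁻ : ∀ {a b} → v (toℕ a) < v (toℕ b) → lookup π a Fin.< lookup π b
  value-<⁻ {a} {b} = subst₂ _<_ (value a) (value b)

  RedVHC⇒RedVHCℕ : RedVHC k Av312 (π , H) → RedVHCℕ n k
  RedVHC⇒RedVHCℕ (((π-inj , π-surj) , ∄312) , V , red , size) = record
    { bounded      = bounded
    ; injective    = injective
    ; surjective   = surjective
    ; avoids       = avoids
    ; hook-<       = hook-<
    ; hook⇒descent = hook⇒descent
    ; descent⇒hook = descent⇒hook
    ; nothingAbove = above
    ; unique       = unique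
    ; nested       = nested
    ; reduced      = reduced
    ; size         = trans (sym (∣H∣ₕ≡#descents r southwest′ sw-unique)) size
    }
    where
    open IsVHC V
    sw-unique : ∀ {i j j′} → (i , j) ∈ₕ H → (i , j′) ∈ₕ H → j ≡ j′
    sw-unique {j = j} {j′} h h′ with Fin.<-cmp (lookup π j) (lookup π j′)
    ... | tri< lt _ _ = contradiction lt (no-shared-sw V h h′)
    ... | tri≈ _ eq _ = π-inj eq
    ... | tri> _ _ gt = contradiction gt (no-shared-sw V h′ h)
    southwest′ : ∀ i → (∃[ j ] (i , j) ∈ₕ H) ⇔ (suc (toℕ i) < n × Descent (toℕ i))
    southwest′ i = mk⇔
      (Equivalence.to (descentTop⇔ r i) ∘ Equivalence.to (southwest i))
      (Equivalence.from (southwest i) ∘ Equivalence.from (descentTop⇔ r i))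
    bounded : ∀ {t} → t < n → v t < n
    bounded t<n with t , refl ← fin t<n = subst (_< n) (sym (value t)) (Fin.toℕ<n _)
    injective : ∀ {s t} → s < n → t < n → v s ≡ v t → s ≡ t
    injective s<n t<n eq with s , refl ← fin s<n | t , refl ← fin t<n =
      cong toℕ (π-inj (Fin.toℕ-injective (trans (sym (value s)) (trans eq (value t)))))
    surjective : ∀ {x} → x < n → ∃[ t ] (t < n × v t ≡ x)
    surjective x<n with x , refl ← fin x<n with t , πt ← π-surj x =
      toℕ t , Fin.toℕ<n t , trans (value t) (cong toℕ (πt refl))
    avoids : ∀ {a b c} → a < b → b < c → c < n → v b < v c → v c < v a → ⊥
    avoids a<b b<c c<n vb<vc vc<va
      with c , refl ← fin c<n
      with b , refl ← fin {n} (ℕ.<-trans b<c c<n)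
      with a , refl ← fin {n} (ℕ.<-trans a<b (ℕ.<-trans b<c c<n)) =
      ∄312 (a , b , c , a<b , b<c , value-<⁻ vb<vc , value-<⁻ vc<va)
    hook-< : ∀ {i j} → j < n → e j ≡ just i → i < j × v i < v j
    hook-< j<n ej with j , refl ← fin j<n with i , refl , h ← hook⁻ ej =
      proj₁ (hooks _ h) , value-< (proj₂ (hooks _ h))
    hook⇒descent : ∀ {i j} → j < n → e j ≡ just i → suc i < n × Descent i
    hook⇒descent j<n ej with j , refl ← fin j<n with i , refl , h ← hook⁻ ej =
      Equivalence.to (southwest′ i) (j , h)
    descent⇒hook : ∀ {i} → suc i < n → Descent i → ∃[ j ] (j < n × e j ≡ just i)
    descent⇒hook lt d with i , refl ← fin {n} (ℕ.<-trans (ℕ.n<1+n _) lt)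
      with j , h ← Equivalence.from (southwest′ i) (lt , d) = toℕ j , Fin.toℕ<n j , hook⁺ h
    above : ∀ {i j l} → j < n → e j ≡ just i → i < l → l < j → ¬ v j < v l
    above j<n ej i<l l<j vj<vl with j , refl ← fin j<n with i , refl , h ← hook⁻ ej
      with l , refl ← fin {n} (ℕ.<-trans l<j j<n) =
      nothingAbove i j h (l , i<l , l<j , value-<⁻ vj<vl)
    unique : ∀ {i j j′} → j < n → j′ < n → e j ≡ just i → e j′ ≡ just i → j ≡ j′
    unique j<n j′<n ej ej′ with j , refl ← fin j<n | j′ , refl ← fin j′<n
      with i , refl , h ← hook⁻ ej with i′ , eq , h′ ← hook⁻ ej′
      with refl ← Fin.toℕ-injective eq = cong toℕ (sw-unique h h′)
    nested : ∀ {i i′ j j′} → j < n → j′ < n → e j ≡ just i → e j′ ≡ just i′ →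
             i < i′ → i′ < j → j < j′ → ⊥
    nested j<n j′<n ej ej′ i<i′ i′<j j<j′ with j , refl ← fin j<n | j′ , refl ← fin j′<n
      with i , refl , h ← hook⁻ ej with i′ , refl , h′ ← hook⁻ ej′ =
      no-crossing V h h′ i<i′ i′<j j<j′
    reduced : ∀ {s} → s < n → (suc s < n × Descent s) ⊎ (∃[ i ] e s ≡ just i) ⊎ DescentInto s
    reduced s<n with s , refl ← fin s<n with red s
    ... | inj₁ h              = inj₁ (Equivalence.to (southwest′ s) h)
    ... | inj₂ (inj₁ (i , h)) = inj₂ (inj₁ (toℕ i , hook⁺ h))
    ... | inj₂ (inj₂ d)       = inj₂ (inj₂ (Equivalence.to (descentBottom⇔ r s) d))

  RedVHCℕ⇒RedVHC : RedVHCℕ n k → RedVHC k Av312 (π , H)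
  RedVHCℕ⇒RedVHC spec =
    (((λ {x} {y} → π-inj {x} {y}) , π-surj) , ∄312) , isVHC , isReduced ,
    trans (∣H∣ₕ≡#descents r southwest′ sw-unique) size
    where
    open RedVHCℕ spec
    π-inj : ∀ {s t} → lookup π s ≡ lookup π t → s ≡ t
    π-inj {s} {t} eq = Fin.toℕ-injective (injective (Fin.toℕ<n s) (Fin.toℕ<n t)
      (trans (value s) (trans (cong toℕ eq) (sym (value t)))))
    π-surj : ∀ y → ∃[ x ] (∀ {z} → z ≡ x → lookup π z ≡ y)
    π-surj y with t , t<n , vt ← surjective (Fin.toℕ<n y) with t , refl ← fin t<n =
      t , λ { refl → Fin.toℕ-injective (trans (sym (value t)) vt) }
    ∄312 : ¬ Contains312 π
    ∄312 (a , b , c , a<b , b<c , πb<πc , πc<πa) =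
      avoids a<b b<c (Fin.toℕ<n c) (value-< πb<πc) (value-< πc<πa)
    hook : ∀ {i j} → (i , j) ∈ₕ H → IsHook π (i , j)
    hook {i} {j} h with i<j , vi<vj ← hook-< (Fin.toℕ<n j) (hook⁺ h) = i<j , value-<⁻ vi<vj
    southwest′ : ∀ i → (∃[ j ] (i , j) ∈ₕ H) ⇔ (suc (toℕ i) < n × Descent (toℕ i))
    southwest′ i = mk⇔ (λ (j , h) → hook⇒descent (Fin.toℕ<n j) (hook⁺ h)) from
      where
      from : suc (toℕ i) < n × Descent (toℕ i) → ∃[ j ] (i , j) ∈ₕ H
      from (lt , d) with j , j<n , ej ← descent⇒hook lt d with j , refl ← fin j<n
        with i′ , eq , h ← hook⁻ ej with refl ← Fin.toℕ-injective eq = j , h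
    sw-unique : ∀ {i j j′} → (i , j) ∈ₕ H → (i , j′) ∈ₕ H → j ≡ j′
    sw-unique {j = j} {j′} h h′ =
      Fin.toℕ-injective (unique (Fin.toℕ<n j) (Fin.toℕ<n j′) (hook⁺ h) (hook⁺ h′))
    ne-unique′ : ∀ {i i′ j} → (i , j) ∈ₕ H → (i′ , j) ∈ₕ H → i ≡ i′
    ne-unique′ h h′ = Fin.toℕ-injective (Maybe.just-injective (trans (sym (hook⁺ h)) (hook⁺ h′)))
    -- The one pair of segments that can meet legitimately: the southwest endpoint of `h` may be the
    -- northeast endpoint of `h′`. Every other order of the endpoints is contradictory.
    crossing : ∀ h h′ → h ∈ₕ H → h′ ∈ₕ H → h ≢ h′ → ∀ p → OnVertical π h p → OnHorizontal π h′ p →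
               IsEndpoint π h p × IsEndpoint π h′ p
    crossing (i , j) (i′ , j′) h h′ h≢h′ (x , y) (refl , πi≤y , y≤πj) (refl , i′≤i , i≤j′)
      with Fin.<-cmp i′ i
    ... | tri≈ _ refl _ = contradiction (cong (i ,_) (sw-unique h h′)) h≢h′
    ... | tri> _ _ i<i′ = contradiction i<i′ (ℕ.≤⇒≯ i′≤i)
    ... | tri< i′<i _ _ with Fin.<-cmp i j′
    ...   | tri≈ _ refl _ = inj₁ refl , inj₂ refl
    ...   | tri> _ _ j′<i = contradiction j′<i (ℕ.≤⇒≯ i≤j′)
    ...   | tri< i<j′ _ _ with Fin.<-cmp j j′
    ...     | tri≈ _ refl _ = contradiction (cong (_, j) (ne-unique′ h h′)) h≢h′
    ...     | tri> _ _ j′<j = ⊥-elim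
                (nested (Fin.toℕ<n j′) (Fin.toℕ<n j) (hook⁺ h′) (hook⁺ h) i′<i i<j′ j′<j)
    -- Here `h` rises to the height of `h′` and ends before it, so its northeast endpoint lies above
    -- `h′`.
    ...     | tri< j<j′ j≢j′ _ = contradiction
                (value-< (Fin.≤∧≢⇒< y≤πj (λ eq → j≢j′ (sym (π-inj eq)))))
                (nothingAbove (Fin.toℕ<n j′) (hook⁺ h′) (ℕ.<-trans i′<i (proj₁ (hook h))) j<j′)
    isVHC : IsVHC π H
    isVHC = record
      { hooks        = λ _ → hook
      ; southwest    = λ i → mk⇔
          (Equivalence.from (descentTop⇔ r i) ∘ Equivalence.to (southwest′ i))
          (Equivalence.from (southwest′ i) ∘ Equivalence.to (descentTop⇔ r i))
      ; nothingAbove = λ { i j h (l , i<l , l<j , lt) →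
          nothingAbove (Fin.toℕ<n j) (hook⁺ h) i<l l<j (value-< lt) }
      ; nonIntersect = disjoint
      }
      where
      disjoint : ∀ h h′ → h ∈ₕ H → h′ ∈ₕ H → h ≢ h′ → ∀ p → OnHook π h p → OnHook π h′ p →
                 IsEndpoint π h p × IsEndpoint π h′ p
      disjoint (i , j) (i′ , j′) h h′ h≢h′ p (inj₁ (refl , _)) (inj₁ (refl , _)) =
        contradiction (cong (i ,_) (sw-unique h h′)) h≢h′
      disjoint h₁ h₂ h h′ h≢h′ p (inj₁ on) (inj₂ on′) = crossing h₁ h₂ h h′ h≢h′ p on on′
      disjoint h₁ h₂ h h′ h≢h′ p (inj₂ on) (inj₁ on′) =
        swap (crossing h₂ h₁ h′ h (h≢h′ ∘ sym) p on′ on)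
      disjoint (i , j) (i′ , j′) h h′ h≢h′ p (inj₂ (refl , _)) (inj₂ (eq , _))
        with refl ← π-inj eq = contradiction (cong (_, j) (ne-unique′ h h′)) h≢h′
    isReduced : IsReduced π H
    isReduced i with reduced (Fin.toℕ<n i)
    ... | inj₁ d = inj₁ (Equivalence.from (southwest′ i) d)
    ... | inj₂ (inj₁ (_ , ei)) with s , _ , h ← hook⁻ ei = inj₂ (inj₁ (s , h))
    ... | inj₂ (inj₂ d) = inj₂ (inj₂ (Equivalence.from (descentBottom⇔ r i) d))

module _ {v : ℕ → ℕ} {e : ℕ → Maybe ℕ} where

  open Points v e

  representable : RedVHCℕ n k → ∃[ c ] Represents {n} c v e
  representable {n} spec = (π , H) , record
    { value = λ t → sym (trans (cong toℕ (Vec.lookup∘tabulate _ t)) (Fin.toℕ-fromℕ< _))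
    ; hook⁺ = λ {i} {j} h → witness (partner? i j) (trans (sym (entry i j)) (Vec.[]=⇒lookup h))
    ; hook⁻ = hook⁻
    }
    where
    open RedVHCℕ spec
    partner? : ∀ i j → Dec (e (toℕ j) ≡ just (toℕ i))
    partner? i j = Maybe.≡-dec ℕ._≟_ (e (toℕ j)) (just (toℕ i))
    witness : ∀ {A : Set} (a? : Dec A) → does a? ≡ true → A
    witness (yes a) refl = a
    π : Word n
    π = tabulate λ t → fromℕ< (bounded (Fin.toℕ<n t))
    H : HookSet n
    H = tabulate λ i → tabulate λ j → does (partner? i j)
    entry : ∀ i j → lookup (lookup H i) j ≡ does (partner? i j)
    entry i j = trans (cong (λ row → lookup row j) (Vec.lookup∘tabulate _ i)) (Vec.lookup∘tabulate _ j)
    hook⁻ : ∀ {j x} → e (toℕ j) ≡ just x → ∃[ i ] (toℕ i ≡ x × (i , j) ∈ₕ H)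
    hook⁻ {j} ej
      with i , refl ← fin {n} (ℕ.<-trans (proj₁ (hook-< (Fin.toℕ<n j) ej)) (Fin.toℕ<n j)) =
      i , refl , Vec.lookup⇒[]= j _ (trans (entry i j) (dec-true (partner? i j) ej))

-- Counting configurations by traces

valueAt-tabulate : ∀ (g : Fin n → ℕ × Maybe ℕ) t → valueAt (List.tabulate g) (toℕ t) ≡ proj₁ (g t)
valueAt-tabulate g Fin.zero    = refl
valueAt-tabulate g (Fin.suc t) = valueAt-tabulate (g ∘ Fin.suc) t

partnerAt-tabulate : ∀ (g : Fin n → ℕ × Maybe ℕ) t → partnerAt (List.tabulate g) (toℕ t) ≡ proj₂ (g t)
partnerAt-tabulate g Fin.zero    = refl
partnerAt-tabulate g (Fin.suc t) = partnerAt-tabulate (g ∘ Fin.suc) t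

IsTrace : Configuration n → Trace → Set
IsTrace {n} c w = length w ≡ n × Represents c (valueAt w) (partnerAt w)

-- Validity makes the partner well defined: the search `sw?` returns some hook ending at `j`, and
-- `ne-unique` shows that there is no other.
trace-exists : (c : Configuration n) → IsVHC (proj₁ c) (proj₂ c) → ∃[ w ] IsTrace c w
trace-exists {n} (π , H) V = w , List.length-tabulate point , record
  { value = valueAt-tabulate point
  ; hook⁺ = λ {i} {j} h → trans (partnerAt-tabulate point j) (found h (sw? j))
  ; hook⁻ = λ {j} {x} eq → source (sw? j) (trans (sym (partnerAt-tabulate point j)) eq)
  }
  where
  sw? : ∀ j → Dec (∃[ i ] (i , j) ∈ₕ H)
  sw? j = Fin.any? λ i → (i , j) ∈ₕ? H
  partner : ∀ {j} → Dec (∃[ i ] (i , j) ∈ₕ H) → Maybe ℕ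
  partner (yes (i , _)) = just (toℕ i)
  partner (no _)        = nothing
  point : Fin n → ℕ × Maybe ℕ
  point j = toℕ (lookup π j) , partner (sw? j)
  w = List.tabulate point
  found : ∀ {i j} → (i , j) ∈ₕ H → (d : Dec (∃[ i ] (i , j) ∈ₕ H)) → partner d ≡ just (toℕ i)
  found h (yes (i′ , h′)) = cong (just ∘ toℕ) (ne-unique V h′ h)
  found h (no ∄)          = contradiction (_ , h) ∄
  source : ∀ {j x} (d : Dec (∃[ i ] (i , j) ∈ₕ H)) → partner d ≡ just x → ∃[ i ] (toℕ i ≡ x × (i , j) ∈ₕ H)
  source (yes (i , h)) refl = i , refl , h

trace-injective : ∀ {c c′ : Configuration n} {w} → IsTrace c w → IsTrace c′ w → c ≡ c′
trace-injective (_ , r) (_ , r′) = represents-injective r r′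

trace-functional : ∀ {c : Configuration n} {w w′} → IsTrace c w → IsTrace c w′ → w ≡ w′
trace-functional {w = w} {w′} (len , r) (len′ , r′) = trace-ext w w′ (trans len (sym len′)) agree
  where
  agree : ∀ {t} → t < length w → valueAt w t ≡ valueAt w′ t × partnerAt w t ≡ partnerAt w′ t
  agree t< with t , refl ← fin (subst (_ <_) len t<) = represents-functional r r′ t

-- Comparing lengths along an injective relation replaces an explicit bijection; with `IsTrace` it
-- is applied once in each direction.
length-≤ : {A B : Set} (R : A → B → Set) → (∀ {x x′ y} → R x y → R x′ y → x ≡ x′) →
           ∀ {xs ys} → Unique xs → (∀ {x} → x ∈ xs → ∃[ y ] (y ∈ ys × R x y)) →
           length xs ≤ length ys
length-≤ R inj []                      related = z≤n
length-≤ {B = B} R inj {x ∷ xs} (x∉xs ∷ xs!) related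
  with y , y∈ , xRy ← related (here refl)
  with ys₁ , ys₂ , refl ← ∈-∃++ y∈ =
  subst (suc (length xs) ≤_) (sym (List.length-++-sucʳ ys₁ y ys₂))
        (s≤s (length-≤ R inj xs! related′))
  where
  related′ : ∀ {x′} → x′ ∈ xs → ∃[ y′ ] (y′ ∈ ys₁ ++ ys₂ × R x′ y′)
  related′ x′∈ with y′ , y′∈ , x′Ry′ ← related (there x′∈) with ∈-++⁻ ys₁ y′∈
  ... | inj₁ y′∈ys₁          = y′ , ∈-++⁺ˡ y′∈ys₁ , x′Ry′
  ... | inj₂ (here refl)     = contradiction (inj xRy x′Ry′) (All.lookup x∉xs x′∈)
  ... | inj₂ (there y′∈ys₂)  = y′ , ∈-++⁺ʳ ys₁ y′∈ys₂ , x′Ry′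

module _ (K k n : ℕ) (n≤K : n ≤ K) where

  encode : ∀ {c w} → RedVHC k (Av312 {n}) c → IsTrace c w → w ∈ traces K k [] [] 0 0
  encode {c} {w} red (refl , r)
    with l , refl , w∈ ← Machine.Run⇒∈ K n (valueAt w) (partnerAt w)
           (Spec.RedVHCℕ⇒Run K n (valueAt w) (partnerAt w) (RedVHC⇒RedVHCℕ r red) n≤K) =
    subst (_∈ _) (segment-lookup w) w∈

  decode : ∀ {w} → w ∈ traces K k [] [] 0 0 → length w ≡ n →
           ∃[ c ] (RedVHC k (Av312 {n}) c × IsTrace c w)
  decode {w} w∈ refl
    with spec ← Spec.Run⇒RedVHCℕ K n (valueAt w) (partnerAt w)
           (Machine.∈⇒Run K n (valueAt w) (partnerAt w) n refl
             (subst (_∈ _) (sym (segment-lookup w)) w∈))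
    with c , r ← representable spec = c , RedVHCℕ⇒RedVHC r spec , refl , r

  #RedVHC-Av312≡ : #RedVHC-Av312 k n ≡ length (ofLength n (traces K k [] [] 0 0))
  #RedVHC-Av312≡ = ℕ.≤-antisym
    (length-≤ IsTrace (λ {_} {_} {w} → trace-injective {w = w}) (redVHCs-unique k av312?) λ {c} c∈ →
      let red = Equivalence.to (∈-redVHCs k av312?) c∈
          w , t = trace-exists c (proj₁ (proj₂ red))
      in w , ∈-filter⁺ _ (encode red t) (proj₁ t) , t)
    (length-≤ (λ w c → IsTrace c w) trace-functional
      (Unique.filter⁺ _ (traces-unique K k [] [] 0 0 [])) λ w∈ →
      let w∈traces , len = ∈-filter⁻ (λ w → length w ℕ.≟ n) w∈
          c , red , t = decode w∈traces len
      in c , Equivalence.from (∈-redVHCs k av312?) red , t)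

corollary5p1p2 : (k : ℕ) → 1 ≤ k →
    (f k (- 1ℤ) ≡ ∑[ i < k ] ((- 1ℤ) ^ toℕ i * + #RedVHC-Av312 k (3 ℕ.* k ∸ toℕ i)))
    × (∑[ i < k ] ((- 1ℤ) ^ toℕ i * + #RedVHC-Av312 k (3 ℕ.* k ∸ toℕ i)) ≡ + catalan k)
corollary5p1p2 k@(suc k-1) _ =
  sum-cong-≗ {k} (λ i → ℤ.*-comm (+ #RedVHC-Av312 k (3 ℕ.* k ∸ toℕ i)) ((- 1ℤ) ^ toℕ i)) ,
  (begin
    ∑[ i < k ] ((- 1ℤ) ^ toℕ i * + #RedVHC-Av312 k (3 ℕ.* k ∸ toℕ i))
      ≡⟨ sum-cong-≗ {k} (λ i → cong (λ l → (- 1ℤ) ^ toℕ i * + l)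
           (#RedVHC-Av312≡ K k (3 ℕ.* k ∸ toℕ i)
             (ℕ.≤-trans (ℕ.m∸n≤m (3 ℕ.* k) (toℕ i)) (ℕ.m≤n+m (3 ℕ.* k) 2)))) ⟩
    sum (term k L)                         ≡⟨ sum-term k L (All.tabulate (trace-length K k-1)) ⟩
    sgn k * signedSum L                    ≡⟨ cong (sgn k *_) (signedSum-traces (3 ℕ.* k) k [] [] 0 0) ⟩
    sgn k * (sgn (k + 0) * + ballot k 0)   ≡⟨ ℤ.*-assoc (sgn k) (sgn (k + 0)) (+ ballot k 0) ⟨
    sgn k * sgn (k + 0) * + ballot k 0
      ≡⟨ cong (λ l → sgn k * sgn l * + ballot k 0) (ℕ.+-identityʳ k) ⟩
    sgn k * sgn k * + ballot k 0           ≡⟨ cong (_* + ballot k 0) (sgn-square k) ⟩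
    1ℤ * + ballot k 0                      ≡⟨ ℤ.*-identityˡ (+ ballot k 0) ⟩
    + ballot k 0                           ≡⟨ cong +_ (ballot≡catalan k) ⟩
    + catalan k                            ∎)
  where
  open ≡-Reasoning
  -- The summand `3k` bounds every length that occurs; the 2 guarantees the choices p = 0 and p = 1
  -- used in the signed count.
  K = 2 + 3 ℕ.* k
  L = traces K k [] [] 0 0
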